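{- For every $d\le 10$, the face vector $(f_0,\ldots,f_{d-1})$ of every cubical $d$-polytope is unimodal, i.e. there is an index $i$ with $f_0\le\cdots\le f_i$ and $f_i\ge\cdots\ge f_{d-1}$.
   Context: A $d$-polytope is cubical if every facet is combinatorially equivalent to the $(d-1)$-cube (equivalently, all proper faces are combinatorially cubes). Its face vector is $(f_0,\ldots,f_{d-1})$, where $f_i$ is the number of $i$-dimensional faces. -}

module Defs where

open import Data.Nat using (ℕ; zero; suc; _<_; _∸_) renaming (_≤_ to _≤ℕ_)
open import Data.Fin using (Fin; zero; suc)
open import Data.Fin.Subset using (Subset; _∈_; _⊆_; Nonempty; ⊤)
open import Data.List using (List; length)
open import Data.List.Relation.Unary.Unique.Propositional using (Unique)
open import Data.List.Membership.Propositional renaming (_∈_ to _∈ₗ_)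
open import Data.Product using (Σ; ∃; ∃₂; _×_; _,_)
open import Data.Unit using () renaming (⊤ to Unit)
open import Data.Empty using (⊥)
open import Function using (_∘_)
open import Relation.Nullary using (¬_)
open import Relation.Binary.PropositionalEquality using (_≡_)
open import Algebra.Structures using (IsCommutativeRing)
open import Relation.Binary.Structures using (IsTotalOrder)

record OrderedField : Set₁ where
  infixl 6 _+_
  infixl 7 _*_
  infix 4 _≤ᶠ_
  field
    Carrier           : Set
    _+_ _*_           : Carrier → Carrier → Carrier
    -_                : Carrier → Carrier
    0# 1#             : Carrier
    _≤ᶠ_              : Carrier → Carrier → Set
    isCommutativeRing : IsCommutativeRing _≡_ _+_ _*_ -_ 0# 1#
    0≢1               : ¬ (0# ≡ 1#)
    inverse           : ∀ x → ¬ (x ≡ 0#) → ∃ λ y → x * y ≡ 1#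
    isTotalOrder      : IsTotalOrder _≡_ _≤ᶠ_
    +-mono            : ∀ x y z → x ≤ᶠ y → x + z ≤ᶠ y + z
    *-nonneg          : ∀ x y → 0# ≤ᶠ x → 0# ≤ᶠ y → 0# ≤ᶠ x * y

-- Nonempty faces of the m-cube [0,1]^m, encoded as sign vectors in {0,1,*}^m,
-- ordered by inclusion.
data CubeCoord : Set where
  lo hi free : CubeCoord

_≤c_ : CubeCoord → CubeCoord → Set
_    ≤c free = Unit
lo   ≤c lo   = Unit
hi   ≤c hi   = Unit
_    ≤c _    = ⊥

CubeFace : ℕ → Set
CubeFace m = Fin m → CubeCoord

_⊑c_ : ∀ {m} → CubeFace m → CubeFace m → Set
τ ⊑c σ = ∀ k → τ k ≤c σ k

Unimodal : ℕ → (ℕ → ℕ) → Set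
Unimodal d f = ∃ λ i → i < d
  × (∀ j → j < i → f j ≤ℕ f (suc j))
  × (∀ j → i ≤ℕ j → suc j < d → f (suc j) ≤ℕ f j)

module _ (K : OrderedField) where
  open OrderedField K

  Point : ℕ → Set
  Point d = Fin d → Carrier

  sumF : ∀ {m} → (Fin m → Carrier) → Carrier
  sumF {zero}  _ = 0#
  sumF {suc m} g = g zero + sumF (g ∘ suc)

  dot : ∀ {d} → Point d → Point d → Carrier
  dot x y = sumF (λ k → x k * y k)

  AffinelyIndependent : ∀ {d m} → (Fin m → Point d) → Set
  AffinelyIndependent {d} {m} w =
    (c : Fin m → Carrier) → sumF c ≡ 0# →
    (∀ k → sumF (λ j → c j * w j k) ≡ 0#) → ∀ j → c j ≡ 0#

  HasAffineDim : ∀ {d n} → (Fin n → Point d) → Subset n → ℕ → Set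
  HasAffineDim {d} {n} V S k =
    (∃ λ (ι : Fin (suc k) → Fin n) → (∀ j → ι j ∈ S) × AffinelyIndependent (V ∘ ι))
    × ¬ (∃ λ (ι : Fin (suc (suc k)) → Fin n) → (∀ j → ι j ∈ S) × AffinelyIndependent (V ∘ ι))

  -- P = conv(V).  A nonempty face of P is P ∩ H for a supporting hyperplane
  -- H = {x | c·x = b} with c·x ≤ b on P; it is recorded by S = V ∩ H,
  -- which determines the face (face = conv(S)).
  IsFace : ∀ {d n} → (Fin n → Point d) → Subset n → Set
  IsFace {d} {n} V S = Nonempty S × ∃₂ λ (c : Point d) (b : Carrier) →
    (∀ j → dot c (V j) ≤ᶠ b)
    × (∀ j → j ∈ S → dot c (V j) ≡ b)
    × (∀ j → dot c (V j) ≡ b → j ∈ S)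

  IsFaceOfDim : ∀ {d n} → (Fin n → Point d) → ℕ → Subset n → Set
  IsFaceOfDim V i S = IsFace V S × HasAffineDim V S i

  FaceCount : ∀ {d n} → (Fin n → Point d) → ℕ → ℕ → Set
  FaceCount {d} {n} V i m = ∃ λ (L : List (Subset n)) →
    length L ≡ m × Unique L
    × (∀ S → S ∈ₗ L → IsFaceOfDim V i S)
    × (∀ S → IsFaceOfDim V i S → S ∈ₗ L)

  IsPolytope : ∀ {d n} → (Fin n → Point d) → Set
  IsPolytope {d} V = HasAffineDim V ⊤ d

  CombCube : ∀ {d n} → (Fin n → Point d) → Subset n → ℕ → Set
  CombCube {d} {n} V S m = ∃ λ (φ : CubeFace m → Subset n) →
    (∀ σ → IsFace V (φ σ) × φ σ ⊆ S)
    × (∀ T → IsFace V T → T ⊆ S → ∃ λ σ → φ σ ≡ T)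
    × (∀ σ τ → φ τ ⊆ φ σ → τ ⊑c σ)
    × (∀ σ τ → τ ⊑c σ → φ τ ⊆ φ σ)

  IsCubical : ∀ {d n} → (Fin n → Point d) → Set
  IsCubical {d} V = ∀ S → IsFaceOfDim V (d ∸ 1) S → CombCube V S (d ∸ 1)

module Submission where

{-
Order the facets of the polytope by their inner normals, normalised and compared
lexicographically.  In the cube of a facet F at a vertex v, a face G ∋ v is the intersection of
the ridges of F in the directions that G does not contain.  Since the normal of any other facet
through G exceeds that of F by a nonnegative combination of the differences to the neighbouring
facets across these ridges, F is the first facet containing G exactly when all these neighbours
come later.  So if x counts the later neighbours of the flag (v , F) and d = 1 + m,
  2^i f_i = Σ C(x, m - i) = Σ C(m - x, m - i)    over all flags (v , F),
the second equation by reversing the order.  Together with (1 + m) f_0 ≤ 2 f_1 (every vertex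
lies on at least d edges) these relations force unimodality for d ≤ 10, by
comparing coefficients.  As equality in the field is not decidable, the geometry takes place under
a double negation, which the decidable conclusion removes.
-}

open import Defs
open import Algebra.Bundles using (CommutativeRing; RawRing)
open import Data.Empty using (⊥; ⊥-elim)
open import Data.Fin using (Fin; zero; suc; toℕ; fromℕ<; cast; punchIn; punchOut)
import Data.Fin.Properties as Fin
open import Data.Fin.Subset using (Subset; _∈_; _∉_; _⊆_; Nonempty; ⊤; _∩_; ∣_∣)
open import Data.Fin.Subset.Properties
  using (_∈?_; _⊆?_; ∈⊤; ⊆-antisym; p⊂q⇒∣p∣<∣q∣; ∣p∣≤n; x∈p∩q⁺; x∈p∩q⁻; p∩q⊆p; p∩q⊆q)
open import Data.Integer as ℤ using (ℤ; -[1+_]; +0; +[1+_])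
import Data.Integer.Properties as ℤ
open import Data.List as List using (List; length; lookup; map; _++_; cartesianProductWith)
import Data.List.Properties as List
open import Data.List.Membership.Propositional using () renaming (_∈_ to _∈ₗ_)
open import Data.List.Membership.Propositional.Properties
  using (∈-lookup; ∈-map⁺; ∈-map⁻; ∈-++⁺ˡ; ∈-++⁺ʳ; ∈-++⁻; ∈-cartesianProductWith⁺; ∈-cartesianProductWith⁻)
import Data.List.Relation.Unary.All as All
open import Data.List.Relation.Unary.Any using (here; there; index)
open import Data.List.Relation.Unary.Any.Properties using (lookup-index)
open import Data.List.Relation.Unary.Unique.Propositional using (Unique)
import Data.List.Relation.Unary.Unique.Propositional.Properties as Unique
import Data.Maybe as Maybe
open import Data.Nat as ℕ using (ℕ; zero; suc; z≤n; s≤s; _≤_; _<_)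
import Data.Nat.Properties as ℕ
open import Data.Nat.Tactic.RingSolver using (solve-∀)
open import Data.Product using (∃; ∃₂; _×_; _,_; proj₁; proj₂)
open import Data.Sum using (_⊎_; inj₁; inj₂; [_,_]′)
import Data.Unit as Unit
open import Data.Vec as Vec using (Vec)
open import Data.Vec.Functional using (updateAt)
open import Data.Vec.Functional.Properties using (updateAt-updates; updateAt-minimal)
open import Data.Vec.Properties
  using (lookup∘tabulate; tabulate∘lookup; tabulate-cong; lookup⇒[]=; []=⇒lookup; ∷-injective; ∷-injectiveʳ; ∷-injectiveˡ)
open import Function using (_∘_; id; case_of_; const; flip)
open import Level using (0ℓ)
open import Relation.Binary.Definitions using (tri<; tri≈; tri>)
open import Relation.Binary.PropositionalEquality
open import Relation.Binary.Structures using (IsDecTotalOrder; IsTotalOrder)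
import Relation.Binary.Construct.Flip.EqAndOrd as Flip
open import Relation.Nullary using (¬_; Dec; yes; no; does; contradiction; ¬¬-excluded-middle)
open import Relation.Nullary.Decidable
  using (toWitness; decidable-stable; dec-true; ¬?; _×-dec_; _→-dec_)
import Relation.Nullary.Decidable as Dec

-- Scaled to value 1 at an interior point, the facet normals are the vertices of a polar polytope,
-- and the facet order sweeps it. A lexicographic sweep requires no choice of a generic functional,
-- and reversing it only negates a cone, so one passage from local to global optimality serves both
-- directions.
--
-- The faces through a vertex `v` are those of a simplicial polytope, its vertex figure, and the
-- numbers of flags at `v` with `x` later neighbours form its h-vector. Summed over `v` they are the
-- short cubical h-vector. Thus the equality of the two sums is the Dehn-Sommerville symmetry, and
-- (1 + m) f_0 ≤ 2 f_1 says h_0 ≤ h_1. Beyond symmetry, this inequality and the nonnegativity of the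
-- counts, nothing about them enters.
--
-- Each inequality between face numbers is linear in these counts, so it is enough to compare
-- coefficients at every `x`. The comparison may fail at the extremes x = 0 and x = m, and this is
-- where a multiple of h_1 - h_0 is spent.
--
-- The record `CubicalSphere` separates the two halves: it is obtained from the geometry under a
-- double negation, while all that is counted from it is decidable.

infixl 1 _>>=_
_>>=_ : ∀ {a b} {A : Set a} {B : Set b} → ¬ ¬ A → (A → ¬ ¬ B) → ¬ ¬ B
(m >>= f) k = m (λ a → f a k)

return : ∀ {a} {A : Set a} → A → ¬ ¬ A
return a k = k a

-- Double negation passes through a product because the index set is finite. With excluded middle at
-- each index it makes any finite family of field equations decidable inside the double negation.
¬¬-Π : ∀ {a} n {P : Fin n → Set a} → (∀ i → ¬ ¬ P i) → ¬ ¬ (∀ i → P i)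
¬¬-Π zero    f = return λ ()
¬¬-Π (suc n) f = do
  p ← f zero
  q ← ¬¬-Π n (f ∘ suc)
  return λ { zero → p ; (suc i) → q i }

¬¬-dec : ∀ {a} n (P : Fin n → Set a) → ¬ ¬ (∀ i → Dec (P i))
¬¬-dec n P = ¬¬-Π n λ _ → ¬¬-excluded-middle

minimum : ∀ {A : Set} {_⊴_ : A → A → Set} → IsTotalOrder _≡_ _⊴_ →
  ∀ n {P : Fin n → Set} (P? : ∀ j → Dec (P j)) (f : Fin n → A) →
  (∃ λ r → P r × ∀ j → P j → f r ⊴ f j) ⊎ (∀ j → ¬ P j)
minimum ⊴-total zero    P? f = inj₂ λ ()
minimum ⊴-total (suc n) P? f with P? zero | minimum ⊴-total n (P? ∘ suc) (f ∘ suc)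
... | no ¬p | inj₂ none = inj₂ λ { zero → ¬p ; (suc j) → none j }
... | no ¬p | inj₁ (r , pr , min) =
  inj₁ (suc r , pr , λ { zero p → contradiction p ¬p ; (suc j) → min j })
... | yes p | inj₂ none = inj₁ (zero , p , λ
  { zero _ → IsTotalOrder.refl ⊴-total ; (suc j) q → contradiction q (none j) })
... | yes p | inj₁ (r , pr , min) with IsTotalOrder.total ⊴-total (f zero) (f (suc r))
...   | inj₁ f0≤fr = inj₁ (zero , p , λ
  { zero _ → IsTotalOrder.refl ⊴-total ; (suc j) q → IsTotalOrder.trans ⊴-total f0≤fr (min j q) })
...   | inj₂ fr≤f0 = inj₁ (suc r , pr , λ { zero _ → fr≤f0 ; (suc j) → min j })

-- Arithmetic in an ordered field

module Field (K : OrderedField) where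
  open OrderedField K public

  commutativeRing : CommutativeRing 0ℓ 0ℓ
  commutativeRing = record { isCommutativeRing = isCommutativeRing }

  open CommutativeRing commutativeRing public
    using (semiring; ring; +-identityˡ; +-identityʳ; +-comm; +-assoc; *-comm; *-assoc;
           *-identityˡ; *-identityʳ; zeroˡ; zeroʳ; distribʳ; -‿inverseʳ)
  open import Algebra.Properties.Ring ring using (-‿distribˡ-*; -‿distribʳ-*; -‿involutive; -0#≈0#)
  open import Algebra.Properties.AbelianGroup (CommutativeRing.+-abelianGroup commutativeRing)
    using (⁻¹-∙-comm)
  open import Algebra.Properties.Semiring.Mult semiring using (×-homo-+; ×1-homo-*) 
    renaming (_×_ to _×′_)
  open import Algebra.Solver.Ring.AlmostCommutativeRing
    using (fromCommutativeRing; _-Raw-AlmostCommutative⟶_)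
  open ≡-Reasoning

  infix 4 _≢0
  _≢0 : Carrier → Set
  x ≢0 = ¬ x ≡ 0#

  open IsTotalOrder isTotalOrder public
    using () renaming (refl to ≤-refl; trans to ≤-trans; antisym to ≤-antisym; total to ≤-total)

  ⟦_⟧ℤ : ℤ → Carrier
  ⟦ ℤ.+ n ⟧ℤ      = n ×′ 1#
  ⟦ -[1+ n ] ⟧ℤ = - (suc n ×′ 1#)

  private
    shift : ∀ a b c → (c + a) + - (c + b) ≡ a + - b
    shift a b c = begin
      (c + a) + - (c + b)     ≡⟨ cong ((c + a) +_) (⁻¹-∙-comm c b) ⟨
      (c + a) + (- c + - b)   ≡⟨ cong (_+ (- c + - b)) (+-comm c a) ⟩
      (a + c) + (- c + - b)   ≡⟨ +-assoc a c _ ⟩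
      a + (c + (- c + - b))   ≡⟨ cong (a +_) (+-assoc c (- c) (- b)) ⟨
      a + ((c + - c) + - b)   ≡⟨ cong (λ z → a + (z + - b)) (-‿inverseʳ c) ⟩
      a + (0# + - b)          ≡⟨ cong (a +_) (+-identityˡ _) ⟩
      a + - b                 ∎

    ⊖-homo : ∀ m n → ⟦ m ℤ.⊖ n ⟧ℤ ≡ m ×′ 1# + - (n ×′ 1#)
    ⊖-homo m zero = begin
      m ×′ 1#             ≡⟨ +-identityʳ _ ⟨
      m ×′ 1# + 0#        ≡⟨ cong (m ×′ 1# +_) -0#≈0# ⟨
      m ×′ 1# + - 0#      ∎
    ⊖-homo zero (suc n) = sym (+-identityˡ _)
    ⊖-homo (suc m) (suc n) = begin
      ⟦ suc m ℤ.⊖ suc n ⟧ℤ                 ≡⟨ cong ⟦_⟧ℤ (ℤ.[1+m]⊖[1+n]≡m⊖n m n) ⟩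
      ⟦ m ℤ.⊖ n ⟧ℤ                         ≡⟨ ⊖-homo m n ⟩
      m ×′ 1# + - (n ×′ 1#)                ≡⟨ shift _ _ 1# ⟨
      suc m ×′ 1# + - (suc n ×′ 1#)        ∎

    -homo : ∀ x → ⟦ ℤ.- x ⟧ℤ ≡ - ⟦ x ⟧ℤ
    -homo +0       = sym -0#≈0#
    -homo +[1+ n ] = refl
    -homo -[1+ n ] = sym (-‿involutive _)

    +-homo : ∀ x y → ⟦ x ℤ.+ y ⟧ℤ ≡ ⟦ x ⟧ℤ + ⟦ y ⟧ℤ
    +-homo (ℤ.+ m) (ℤ.+ n) = ×-homo-+ 1# m n
    +-homo (ℤ.+ m) -[1+ n ] = ⊖-homo m (suc n)
    +-homo -[1+ m ] (ℤ.+ n) = trans (⊖-homo n (suc m)) (+-comm _ _)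
    +-homo -[1+ m ] -[1+ n ] = begin
      - (suc (suc (m ℕ.+ n)) ×′ 1#)          ≡⟨ cong (λ k → - (suc k ×′ 1#)) (ℕ.+-suc m n) ⟨
      - ((suc m ℕ.+ suc n) ×′ 1#)            ≡⟨ cong -_ (×-homo-+ 1# (suc m) (suc n)) ⟩
      - (suc m ×′ 1# + suc n ×′ 1#)          ≡⟨ ⁻¹-∙-comm _ _ ⟨
      - (suc m ×′ 1#) + - (suc n ×′ 1#)      ∎

    *-homo⁺ : ∀ m y → ⟦ ℤ.+ m ℤ.* y ⟧ℤ ≡ (m ×′ 1#) * ⟦ y ⟧ℤ
    *-homo⁺ m (ℤ.+ n) = trans (cong ⟦_⟧ℤ (sym (ℤ.pos-* m n))) (×1-homo-* m n)
    *-homo⁺ m -[1+ n ] = begin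
      ⟦ ℤ.+ m ℤ.* ℤ.- ℤ.+ suc n ⟧ℤ             ≡⟨ cong ⟦_⟧ℤ (ℤ.neg-distribʳ-* (ℤ.+ m) (ℤ.+ suc n)) ⟨
      ⟦ ℤ.- (ℤ.+ m ℤ.* ℤ.+ suc n) ⟧ℤ           ≡⟨ -homo (ℤ.+ m ℤ.* ℤ.+ suc n) ⟩
      - ⟦ ℤ.+ m ℤ.* ℤ.+ suc n ⟧ℤ               ≡⟨ cong -_ (*-homo⁺ m (ℤ.+ suc n)) ⟩
      - ((m ×′ 1#) * (suc n ×′ 1#))        ≡⟨ -‿distribʳ-* _ _ ⟩
      (m ×′ 1#) * - (suc n ×′ 1#)          ∎

    *-homo : ∀ x y → ⟦ x ℤ.* y ⟧ℤ ≡ ⟦ x ⟧ℤ * ⟦ y ⟧ℤ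
    *-homo (ℤ.+ m) y = *-homo⁺ m y
    *-homo -[1+ m ] y = begin
      ⟦ (ℤ.- ℤ.+ suc m) ℤ.* y ⟧ℤ             ≡⟨ cong ⟦_⟧ℤ (ℤ.neg-distribˡ-* (ℤ.+ suc m) y) ⟨
      ⟦ ℤ.- (ℤ.+ suc m ℤ.* y) ⟧ℤ             ≡⟨ -homo (ℤ.+ suc m ℤ.* y) ⟩
      - ⟦ ℤ.+ suc m ℤ.* y ⟧ℤ                 ≡⟨ cong -_ (*-homo⁺ (suc m) y) ⟩
      - ((suc m ×′ 1#) * ⟦ y ⟧ℤ)           ≡⟨ -‿distribˡ-* _ _ ⟩
      - (suc m ×′ 1#) * ⟦ y ⟧ℤ             ∎

    ℤ-rawRing : RawRing 0ℓ 0ℓ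
    ℤ-rawRing = record
      { Carrier = ℤ ; _≈_ = _≡_ ; _+_ = ℤ._+_ ; _*_ = ℤ._*_ ; -_ = ℤ.-_ ; 0# = +0 ; 1# = ℤ.+ 1 }

    morphism : ℤ-rawRing -Raw-AlmostCommutative⟶ fromCommutativeRing commutativeRing
    morphism = record
      { ⟦_⟧ = ⟦_⟧ℤ ; +-homo = +-homo ; *-homo = *-homo ; -‿homo = -homo
      ; 0-homo = refl ; 1-homo = +-identityʳ 1# }

  -- Integer coefficients let the solver cancel, although equality in K is not decidable.
  open import Algebra.Solver.Ring ℤ-rawRing (fromCommutativeRing commutativeRing) morphism
    (λ x y → Maybe.map (cong ⟦_⟧ℤ) (Dec.dec⇒maybe (x ℤ.≟ y))) public
    using (solve; _:=_; _:+_; _:*_; :-_; _:-_; con)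

  cancel : ∀ {x y} → x ≢0 → x * y ≡ 0# → y ≡ 0#
  cancel {x} {y} x≢0 xy≡0 with inverse x x≢0
  ... | z , xz≡1 = begin
    y              ≡⟨ *-identityˡ y ⟨
    1# * y         ≡⟨ cong (_* y) xz≡1 ⟨
    x * z * y      ≡⟨ solve 3 (λ x y z → x :* z :* y := z :* (x :* y)) refl x y z ⟩
    z * (x * y)    ≡⟨ cong (z *_) xy≡0 ⟩
    z * 0#         ≡⟨ zeroʳ z ⟩
    0#             ∎

  neg-zero : ∀ {x} → x ≡ 0# → - x ≡ 0#
  neg-zero refl = solve 0 (:- con ℤ.+0 := con ℤ.+0) refl

  neg-zero⁻¹ : ∀ {x} → - x ≡ 0# → x ≡ 0#
  neg-zero⁻¹ {x} e = trans (solve 1 (λ x → x := :- :- x) refl x) (neg-zero e)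

  neg-nonneg : ∀ {x} → x ≤ᶠ 0# → 0# ≤ᶠ - x
  neg-nonneg {x} x≤0 =
    subst₂ _≤ᶠ_ (-‿inverseʳ x) (+-identityˡ (- x)) (+-mono x 0# (- x) x≤0)

  +-nonneg : ∀ {x y} → 0# ≤ᶠ x → 0# ≤ᶠ y → 0# ≤ᶠ x + y
  +-nonneg {x} {y} 0≤x 0≤y =
    ≤-trans 0≤y (subst (_≤ᶠ x + y) (+-identityˡ y) (+-mono 0# x y 0≤x))

  +-nonneg-≡0 : ∀ {x y} → 0# ≤ᶠ x → 0# ≤ᶠ y → x + y ≡ 0# → x ≡ 0#
  +-nonneg-≡0 {x} {y} 0≤x 0≤y x+y≡0 = ≤-antisym
    (subst₂ _≤ᶠ_ (+-identityˡ x) (trans (+-comm y x) x+y≡0) (+-mono 0# y x 0≤y)) 0≤x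

  inverse-nonneg : ∀ {x y} → 0# ≤ᶠ x → x * y ≡ 1# → 0# ≤ᶠ y
  inverse-nonneg {x} {y} 0≤x xy≡1 =
    -- When `y` is nonpositive it is still nonnegative, being the product of `x` with the square of
    -- `y`.
    [ id , (λ y≤0 → subst (0# ≤ᶠ_) eq (*-nonneg _ _ 0≤x (*-nonneg _ _ (neg-nonneg y≤0) (neg-nonneg y≤0)))) ]′
    (≤-total 0# y)
    where
    eq : x * (- y * - y) ≡ y
    eq = begin
      x * (- y * - y)    ≡⟨ solve 2 (λ x y → x :* (:- y :* :- y) := (x :* y) :* y) refl x y ⟩
      x * y * y          ≡⟨ cong (_* y) xy≡1 ⟩
      1# * y             ≡⟨ *-identityˡ y ⟩
      y                  ∎

  x-y≡0⇒x≡y : ∀ {x y} → x + - y ≡ 0# → x ≡ y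
  x-y≡0⇒x≡y {x} {y} e = begin
    x              ≡⟨ solve 2 (λ x y → x := (x :+ :- y) :+ y) refl x y ⟩
    x + - y + y    ≡⟨ cong (_+ y) e ⟩
    0# + y         ≡⟨ +-identityˡ y ⟩
    y              ∎

  0≤y-x⇒x≤y : ∀ {x y} → 0# ≤ᶠ y + - x → x ≤ᶠ y
  0≤y-x⇒x≤y {x} {y} h = subst₂ _≤ᶠ_ (+-identityˡ x)
    (solve 2 (λ x y → (y :+ :- x) :+ x := y) refl x y) (+-mono _ _ x h)

  x≤y⇒0≤y-x : ∀ {x y} → x ≤ᶠ y → 0# ≤ᶠ y + - x
  x≤y⇒0≤y-x {x} {y} h = subst (_≤ᶠ y + - x) (-‿inverseʳ x) (+-mono _ _ (- x) h)

-- Linear algebra: kernels and independence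

module Linear (K : OrderedField) where
  open Field K public
  open import Algebra.Properties.Semiring.Sum semiring public
    using (sum; sum-cong-≗; sum-remove; ∑-distrib-+; ∑-comm; *-distribˡ-sum; sum-replicate-zero)
  open import Data.Vec.Functional using (_∷_)
  open ≡-Reasoning

  Vect : ℕ → Set
  Vect N = Fin N → Carrier

  ⟨_,_⟩ : ∀ {N} → Vect N → Vect N → Carrier
  ⟨ a , x ⟩ = sum λ k → a k * x k

  comb : ∀ {m N} → Vect m → (Fin m → Vect N) → Vect N
  comb c w k = sum λ j → c j * w j k

  Indep : ∀ {m N} → (Fin m → Vect N) → Set
  Indep {m} w = (c : Vect m) → (∀ k → comb c w k ≡ 0#) → ∀ j → c j ≡ 0#

  Kernel : ∀ {m N} → (Fin m → Vect N) → Set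
  Kernel {m} {N} A = ∃ λ (c : Vect N) → (∃ λ j → c j ≢0) × (∀ i → ⟨ A i , c ⟩ ≡ 0#)

  sum-zero : ∀ {m} {f : Vect m} → (∀ j → f j ≡ 0#) → sum f ≡ 0#
  sum-zero {m} f≡0 = trans (sum-cong-≗ f≡0) (sum-replicate-zero m)

  sum-single : ∀ {m} (f : Vect m) i → (∀ k → k ≢ i → f k ≡ 0#) → sum f ≡ f i
  sum-single {suc m} f i f≡0 = begin
    sum f                       ≡⟨ sum-remove {i = i} f ⟩
    f i + sum (f ∘ punchIn i)   ≡⟨ cong (f i +_) (sum-zero λ k → f≡0 _ (Fin.punchInᵢ≢i i k)) ⟩
    f i + 0#                    ≡⟨ +-identityʳ _ ⟩
    f i                         ∎

  sum-nonneg : ∀ {m} (f : Vect m) → (∀ j → 0# ≤ᶠ f j) → 0# ≤ᶠ sum f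
  sum-nonneg {zero}  f h = ≤-refl
  sum-nonneg {suc m} f h = +-nonneg (h zero) (sum-nonneg (f ∘ suc) (h ∘ suc))

  sum-nonneg-≡0 : ∀ {m} (f : Vect m) → (∀ j → 0# ≤ᶠ f j) → sum f ≡ 0# → ∀ j → f j ≡ 0#
  sum-nonneg-≡0 {suc m} f h e j = +-nonneg-≡0 (h j) (sum-nonneg (f ∘ punchIn j) (h ∘ punchIn j))
    (trans (sym (sum-remove {i = j} f)) e)

  pair-comb : ∀ {m N} (a : Vect N) (c : Vect m) w → ⟨ a , comb c w ⟩ ≡ sum λ j → c j * ⟨ a , w j ⟩
  pair-comb a c w = begin
    sum (λ k → a k * sum (λ j → c j * w j k))
      ≡⟨ sum-cong-≗ (λ k → *-distribˡ-sum (a k) (λ j → c j * w j k)) ⟩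
    sum (λ k → sum (λ j → a k * (c j * w j k)))
      ≡⟨ ∑-comm (λ k j → a k * (c j * w j k)) ⟩
    sum (λ j → sum (λ k → a k * (c j * w j k)))
      ≡⟨ sum-cong-≗ (λ j → trans
           (sum-cong-≗ λ k → solve 3 (λ x y z → x :* (y :* z) := y :* (x :* z)) refl (a k) (c j) (w j k))
           (sym (*-distribˡ-sum (c j) (λ k → a k * w j k)))) ⟩
    sum (λ j → c j * ⟨ a , w j ⟩) ∎

  pair-+ : ∀ {N} (a b x : Vect N) → ⟨ (λ k → a k + b k) , x ⟩ ≡ ⟨ a , x ⟩ + ⟨ b , x ⟩
  pair-+ a b x = trans (sum-cong-≗ λ k → distribʳ (x k) (a k) (b k)) (∑-distrib-+ (λ k → a k * x k) (λ k → b k * x k))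

  pair-* : ∀ {N} s (a x : Vect N) → ⟨ (λ k → s * a k) , x ⟩ ≡ s * ⟨ a , x ⟩
  pair-* s a x = trans (sum-cong-≗ λ k → *-assoc s (a k) (x k)) (sym (*-distribˡ-sum s (λ k → a k * x k)))

  pair-neg : ∀ {N} (a x : Vect N) → ⟨ (λ k → - a k) , x ⟩ ≡ - ⟨ a , x ⟩
  pair-neg a x = begin
    ⟨ (λ k → - a k) , x ⟩          ≡⟨ sum-cong-≗ (λ k → solve 2 (λ a x → :- a :* x := :- con (ℤ.+ 1) :* (a :* x)) refl (a k) (x k)) ⟩
    sum (λ k → - ⟦ ℤ.+ 1 ⟧ℤ * (a k * x k))  ≡⟨ *-distribˡ-sum (- ⟦ ℤ.+ 1 ⟧ℤ) (λ k → a k * x k) ⟨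
    - ⟦ ℤ.+ 1 ⟧ℤ * ⟨ a , x ⟩       ≡⟨ solve 1 (λ y → :- con (ℤ.+ 1) :* y := :- y) refl _ ⟩
    - ⟨ a , x ⟩                    ∎

  pair-zeroˡ : ∀ {N} (x : Vect N) → ⟨ (λ _ → 0#) , x ⟩ ≡ 0#
  pair-zeroˡ x = sum-zero λ k → zeroˡ (x k)

  pair-zeroʳ : ∀ {N} (a : Vect N) {x : Vect N} → (∀ k → x k ≡ 0#) → ⟨ a , x ⟩ ≡ 0#
  pair-zeroʳ a h = sum-zero λ k → trans (cong (a k *_) (h k)) (zeroʳ _)

  relation-pair : ∀ {m N} (c : Vect m) (w : Fin m → Vect N) → (∀ k → comb c w k ≡ 0#) →
    ∀ a → sum (λ j → c j * ⟨ a , w j ⟩) ≡ 0#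
  relation-pair c w rel a = trans (sym (pair-comb a c w)) (pair-zeroʳ a rel)

  -- Pairing a relation with `a` leaves only the coefficient of `x`.
  indep-∷ : ∀ {m N} {w : Fin m → Vect N} {x} a → Indep w →
    (∀ j → ⟨ a , w j ⟩ ≡ 0#) → ⟨ a , x ⟩ ≢0 → Indep (x ∷ w)
  indep-∷ {w = w} {x} a ind aw≡0 ax≢0 c rel = λ { zero → c₀≡0 ; (suc j) → ind (c ∘ suc) rel′ j }
    where
    c₀≡0 : c zero ≡ 0#
    c₀≡0 = cancel ax≢0 (begin
      ⟨ a , x ⟩ * c zero          ≡⟨ *-comm _ _ ⟩
      c zero * ⟨ a , x ⟩          ≡⟨ +-identityʳ _ ⟨
      c zero * ⟨ a , x ⟩ + 0#
        ≡⟨ cong (c zero * ⟨ a , x ⟩ +_)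
             (sum-zero λ j → trans (cong (c (suc j) *_) (aw≡0 j)) (zeroʳ _)) ⟨
      sum (λ j → c j * ⟨ a , (x ∷ w) j ⟩) ≡⟨ relation-pair c (x ∷ w) rel a ⟩
      0# ∎)
    rel′ : ∀ k → comb (c ∘ suc) w k ≡ 0#
    rel′ k = begin
      comb (c ∘ suc) w k                   ≡⟨ +-identityˡ _ ⟨
      0# + comb (c ∘ suc) w k              ≡⟨ cong (_+ comb (c ∘ suc) w k) (zeroˡ (x k)) ⟨
      0# * x k + comb (c ∘ suc) w k        ≡⟨ cong (λ z → z * x k + comb (c ∘ suc) w k) c₀≡0 ⟨
      comb c (x ∷ w) k                     ≡⟨ rel k ⟩
      0#                                   ∎

  indep-punchIn : ∀ {m N} {w : Fin (suc m) → Vect N} i → Indep w → Indep (w ∘ punchIn i)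
  indep-punchIn {m} {w = w} i ind c rel j =
    trans (sym (at-punchIn j)) (ind c′ rel′ (punchIn i j))
    where
    open import Data.Vec.Functional using (insertAt)
    open import Data.Vec.Functional.Properties using (insertAt-lookup; insertAt-punchIn)
    c′ : Vect (suc m)
    c′ = insertAt c i 0#
    at-punchIn : ∀ j → c′ (punchIn i j) ≡ c j
    at-punchIn = insertAt-punchIn c i 0#
    rel′ : ∀ k → comb c′ w k ≡ 0#
    rel′ k = begin
      comb c′ w k                ≡⟨ sum-remove {i = i} (λ j → c′ j * w j k) ⟩
      c′ i * w i k + sum (λ j → c′ (punchIn i j) * w (punchIn i j) k)
        ≡⟨ cong₂ _+_ (trans (cong (_* w i k) (insertAt-lookup c i 0#)) (zeroˡ _))
             (trans (sum-cong-≗ λ j → cong (_* w (punchIn i j) k) (at-punchIn j)) (rel k)) ⟩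
      0# + 0#                    ≡⟨ +-identityˡ 0# ⟩
      0#                         ∎

  -- Up to scaling, `γ` is a dual family for `w`: pairing a relation with `γ i` isolates the
  -- coefficient of `w i`. Only `x` then remains, and its nonzero coordinate `k` settles it. The
  -- intended `x` is a vertex, `w` its neighbours and `γ` the functionals of the ridges.
  indep-dual : ∀ {m N} {w : Fin m → Vect N} {x} k (γ : Fin m → Vect N) → x k ≢0 →
    (∀ i → ⟨ γ i , x ⟩ ≡ 0#) → (∀ i j → j ≢ i → ⟨ γ i , w j ⟩ ≡ 0#) → (∀ i → ⟨ γ i , w i ⟩ ≢0) →
    Indep (x ∷ w)
  indep-dual {w = w} {x} k γ xk≢0 γx≡0 γw≡0 γw≢0 c rel = λ { zero → c₀≡0 ; (suc j) → c≡0 j }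
    where
    c≡0 : ∀ i → c (suc i) ≡ 0#
    c≡0 i = cancel (γw≢0 i) (begin
      ⟨ γ i , w i ⟩ * c (suc i)    ≡⟨ *-comm _ _ ⟩
      c (suc i) * ⟨ γ i , w i ⟩
        ≡⟨ sum-single _ i (λ j j≢i → trans (cong (c (suc j) *_) (γw≡0 i j j≢i)) (zeroʳ _)) ⟨
      sum (λ j → c (suc j) * ⟨ γ i , w j ⟩)    ≡⟨ +-identityˡ _ ⟨
      0# + sum (λ j → c (suc j) * ⟨ γ i , w j ⟩)
        ≡⟨ cong (_+ sum (λ j → c (suc j) * ⟨ γ i , w j ⟩)) (trans (cong (c zero *_) (γx≡0 i)) (zeroʳ _)) ⟨
      sum (λ j → c j * ⟨ γ i , (x ∷ w) j ⟩)    ≡⟨ relation-pair c (x ∷ w) rel (γ i) ⟩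
      0# ∎)
    c₀≡0 : c zero ≡ 0#
    c₀≡0 = cancel xk≢0 (begin
      x k * c zero                   ≡⟨ *-comm _ _ ⟩
      c zero * x k                   ≡⟨ +-identityʳ _ ⟨
      c zero * x k + 0#
        ≡⟨ cong (c zero * x k +_) (sum-zero λ j → trans (cong (_* w j k) (c≡0 j)) (zeroˡ _)) ⟨
      comb c (x ∷ w) k               ≡⟨ rel k ⟩
      0#                             ∎)

  -- Gaussian elimination on the columns; the pivot rows form the independent family.
  rank-alternative : ∀ p m (A : Fin m → Vect p) →
    ¬ ¬ (Kernel A ⊎ (p ℕ.≤ m × ∃ λ (ι : Fin p → Fin m) → Indep (A ∘ ι)))
  rank-alternative zero m A = return (inj₂ (z≤n , (λ ()) , λ _ _ ()))
  rank-alternative (suc p) m A = do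
    A₀≡0? ← ¬¬-dec m (λ i → A i zero ≡ 0#)
    case Fin.all? A₀≡0? of λ where
      (yes A₀≡0) → return (inj₁ (zero-column A₀≡0))
      (no ¬A₀≡0) → case Fin.¬∀⟶∃¬ m _ A₀≡0? ¬A₀≡0 of λ { (i , Ai≢0) → eliminate A i Ai≢0 }
    where
    zero-column : (∀ i → A i zero ≡ 0#) → Kernel A
    zero-column A₀≡0 = e , (zero , λ 1≡0 → 0≢1 (sym 1≡0)) , λ i → begin
      A i zero * 1# + sum (λ k → A i (suc k) * 0#)
        ≡⟨ cong₂ _+_ (trans (cong (_* 1#) (A₀≡0 i)) (zeroˡ _)) (sum-zero λ k → zeroʳ (A i (suc k))) ⟩
      0# + 0# ≡⟨ +-identityˡ 0# ⟩
      0# ∎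
      where
      e : Vect (suc p)
      e zero    = 1#
      e (suc _) = 0#

    eliminate : ∀ {m} (A : Fin m → Vect (suc p)) i → A i zero ≢0 →
      ¬ ¬ (Kernel A ⊎ (suc p ℕ.≤ m × ∃ λ (ι : Fin (suc p) → Fin m) → Indep (A ∘ ι)))
    eliminate {suc m} A i Ai≢0 = do
      inj₁ (c , c≢0 , ker) ← rank-alternative p m A′
        where inj₂ (p≤m , ι , ind) → return (inj₂ (s≤s p≤m , i ∷ (punchIn i ∘ ι) , independent ι ind))
      return (inj₁ (extend c , (suc (proj₁ c≢0) , proj₂ c≢0) , kernel c ker))
      where
      y : Carrier
      y = proj₁ (inverse _ Ai≢0)
      Ay≡1 : A i zero * y ≡ 1#
      Ay≡1 = proj₂ (inverse _ Ai≢0)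
      t : Fin m → Carrier
      t r = A (punchIn i r) zero * y
      A′ : Fin m → Vect p
      A′ r l = A (punchIn i r) (suc l) + - t r * A i (suc l)
      s : Vect p → Carrier
      s c = ⟨ A i ∘ suc , c ⟩
      -- The new entry is the solution of the pivot equation for given remaining entries.
      extend : Vect p → Vect (suc p)
      extend c zero    = - (y * s c)
      extend c (suc k) = c k

      kernel-i : ∀ c → ⟨ A i , extend c ⟩ ≡ 0#
      kernel-i c = begin
        A i zero * - (y * s c) + s c
          ≡⟨ solve 3 (λ a y s → a :* :- (y :* s) :+ s := :- (a :* y) :* s :+ s) refl (A i zero) y (s c) ⟩
        - (A i zero * y) * s c + s c    ≡⟨ cong (λ z → - z * s c + s c) Ay≡1 ⟩
        - 1# * s c + s c                ≡⟨ cong (- 1# * s c +_) (*-identityˡ _) ⟨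
        - 1# * s c + 1# * s c           ≡⟨ solve 2 (λ x y → :- x :* y :+ x :* y := con +0) refl 1# (s c) ⟩
        0#                              ∎

      kernel-punchIn : ∀ c r → ⟨ A′ r , c ⟩ ≡ 0# → ⟨ A (punchIn i r) , extend c ⟩ ≡ 0#
      kernel-punchIn c r A′c≡0 = begin
        a₀ * - (y * s c) + u
          ≡⟨ solve 4 (λ a y s u → a :* :- (y :* s) :+ u := u :+ :- (a :* y) :* s) refl a₀ y (s c) u ⟩
        u + - t r * s c                     ≡⟨ cong (u +_) (pair-* (- t r) _ c) ⟨
        u + ⟨ (λ l → - t r * A i (suc l)) , c ⟩  ≡⟨ pair-+ (A (punchIn i r) ∘ suc) _ c ⟨
        ⟨ A′ r , c ⟩                        ≡⟨ A′c≡0 ⟩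
        0#                                  ∎
        where
        a₀ = A (punchIn i r) zero
        u = ⟨ A (punchIn i r) ∘ suc , c ⟩

      kernel : ∀ c → (∀ r → ⟨ A′ r , c ⟩ ≡ 0#) → ∀ r → ⟨ A r , extend c ⟩ ≡ 0#
      kernel c ker r with i Fin.≟ r
      ... | yes refl = kernel-i c
      ... | no i≢r   = subst (λ r → ⟨ A r , extend c ⟩ ≡ 0#) (Fin.punchIn-punchOut i≢r)
                         (kernel-punchIn c (punchOut i≢r) (ker _))

      independent : ∀ ι → Indep (A′ ∘ ι) → Indep (A ∘ (i ∷ (punchIn i ∘ ι)))
      independent ι ind e rel = λ { zero → e₀≡0 ; (suc j) → e≡0 j }
        where
        P : Fin p → Fin (suc m)
        P j = punchIn i (ι j)
        τ E : Carrier
        τ = sum λ j → e (suc j) * t (ι j)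
        -- This is column zero of the relation divided by the pivot. It is the multiple of row `i`
        -- by which a relation among the rows of `A` differs from one among the rows of `A′`.
        E = e zero + τ
        E≡0 : E ≡ 0#
        E≡0 = begin
          e zero + τ
            ≡⟨ cong (_+ τ) (trans (cong (e zero *_) Ay≡1) (*-identityʳ _)) ⟨
          e zero * (A i zero * y) + τ
            ≡⟨ cong (e zero * (A i zero * y) +_) (begin
                 τ ≡⟨ sum-cong-≗ (λ j → solve 3 (λ e a y → e :* (a :* y) := y :* (e :* a)) refl (e (suc j)) (A (P j) zero) y) ⟩
                 sum (λ j → y * (e (suc j) * A (P j) zero)) ≡⟨ *-distribˡ-sum y (λ j → e (suc j) * A (P j) zero) ⟨
                 y * σ ∎) ⟩
          e zero * (A i zero * y) + y * σ
            ≡⟨ solve 4 (λ e a y σ → e :* (a :* y) :+ y :* σ := y :* (e :* a :+ σ)) refl (e zero) (A i zero) y σ ⟩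
          y * (e zero * A i zero + σ)         ≡⟨ cong (y *_) (rel zero) ⟩
          y * 0#                              ≡⟨ zeroʳ y ⟩
          0#                                  ∎
          where
          σ : Carrier
          σ = sum λ j → e (suc j) * A (P j) zero
        rel′ : ∀ l → comb (e ∘ suc) (A′ ∘ ι) l ≡ 0#
        rel′ l = begin
          sum (λ j → e (suc j) * (A (P j) (suc l) + - t (ι j) * A i (suc l)))
            ≡⟨ sum-cong-≗ (λ j → solve 4 (λ e a t b → e :* (a :+ :- t :* b) := e :* a :+ :- b :* (e :* t)) refl
                 (e (suc j)) (A (P j) (suc l)) (t (ι j)) (A i (suc l))) ⟩
          sum (λ j → e (suc j) * A (P j) (suc l) + - A i (suc l) * (e (suc j) * t (ι j)))
            ≡⟨ ∑-distrib-+ (λ j → e (suc j) * A (P j) (suc l)) _ ⟩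
          σ + sum (λ j → - A i (suc l) * (e (suc j) * t (ι j)))
            ≡⟨ cong (σ +_) (*-distribˡ-sum (- A i (suc l)) (λ j → e (suc j) * t (ι j))) ⟨
          σ + - A i (suc l) * τ
            ≡⟨ solve 4 (λ e b σ τ → σ :+ :- b :* τ := (e :* b :+ σ) :+ :- (b :* (e :+ τ))) refl (e zero) (A i (suc l)) σ τ ⟩
          (e zero * A i (suc l) + σ) + - (A i (suc l) * E)
            ≡⟨ cong₂ (λ x z → x + - (A i (suc l) * z)) (rel (suc l)) E≡0 ⟩
          0# + - (A i (suc l) * 0#)
            ≡⟨ solve 1 (λ a → con +0 :+ :- (a :* con +0) := con +0) refl (A i (suc l)) ⟩
          0# ∎
          where
          σ : Carrier
          σ = sum λ j → e (suc j) * A (P j) (suc l)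
        e≡0 : ∀ j → e (suc j) ≡ 0#
        e≡0 = ind (e ∘ suc) rel′
        e₀≡0 : e zero ≡ 0#
        e₀≡0 = begin
          e zero        ≡⟨ +-identityʳ _ ⟨
          e zero + 0#   ≡⟨ cong (e zero +_) (sum-zero λ j → trans (cong (_* t (ι j)) (e≡0 j)) (zeroˡ _)) ⟨
          E             ≡⟨ E≡0 ⟩
          0#            ∎

  kernel-wide : ∀ m (A : Fin m → Vect (suc m)) → ¬ ¬ Kernel A
  kernel-wide m A = do
    inj₁ ker ← rank-alternative (suc m) m A
      where inj₂ (1+m≤m , _) → contradiction 1+m≤m (ℕ.<-irrefl refl)
    return ker

  -- Were `a k` nonzero, delete coordinate `k`: the `N` shortened vectors have a nontrivial
  -- relation, and pairing with `a` shows that it holds in coordinate `k` as well, against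
  -- independence.
  indep-full : ∀ {N} (w : Fin N → Vect N) → Indep w →
    ∀ a → (∀ j → ⟨ a , w j ⟩ ≡ 0#) → ∀ k → ¬ ¬ (a k ≡ 0#)
  indep-full {suc M} w ind a aw≡0 k ak≢0 =
    kernel-wide M (λ l j → w j (punchIn k l)) λ { (c , (j , cj≢0) , ker) →
      let
        comb≡0 : ∀ l → comb c w (punchIn k l) ≡ 0#
        comb≡0 l = trans (sum-cong-≗ λ j → *-comm (c j) (w j (punchIn k l))) (ker l)
        combₖ≡0 : comb c w k ≡ 0#
        combₖ≡0 = cancel ak≢0 (begin
          a k * comb c w k
            ≡⟨ sum-single (λ l → a l * comb c w l) k (λ l l≢k → trans (cong (a l *_)
                 (subst (λ l → comb c w l ≡ 0#) (Fin.punchIn-punchOut (l≢k ∘ sym)) (comb≡0 _))) (zeroʳ _)) ⟨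
          ⟨ a , comb c w ⟩                 ≡⟨ pair-comb a c w ⟩
          sum (λ j → c j * ⟨ a , w j ⟩)    ≡⟨ sum-zero (λ j → trans (cong (c j *_) (aw≡0 j)) (zeroʳ _)) ⟩
          0# ∎)
        rel : ∀ l → comb c w l ≡ 0#
        rel l = case k Fin.≟ l of λ where
          (yes refl) → combₖ≡0
          (no k≢l)   → subst (λ l → comb c w l ≡ 0#) (Fin.punchIn-punchOut k≢l) (comb≡0 _)
      in cj≢0 (ind c rel j) }

-- Supporting hyperplanes and facets

subsetOf : ∀ {a n} {P : Fin n → Set a} → (∀ i → Dec (P i)) →
  ∃ λ (S : Subset n) → (∀ i → i ∈ S → P i) × (∀ i → P i → i ∈ S)
subsetOf {P = P} P? = S , to , from
  where
  S = Vec.tabulate (does ∘ P?)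
  to : ∀ i → i ∈ S → P i
  to i i∈S with P? i | trans (sym (lookup∘tabulate (does ∘ P?) i)) ([]=⇒lookup i∈S)
  ... | yes p | _ = p
  from : ∀ i → P i → i ∈ S
  from i p = lookup⇒[]= i S (trans (lookup∘tabulate (does ∘ P?) i) (dec-true (P? i) p))

module Geometry (K : OrderedField) {d n : ℕ} (V : Fin n → Point K d) where
  open Linear K
  open import Data.Vec.Functional using (_∷_)
  open ≡-Reasoning

  -- Homogeneous coordinates: affine independence becomes linear independence, and affine
  -- functionals become covectors.
  W : Fin n → Vect (suc d)
  W j zero    = 1#
  W j (suc k) = V j k

  sumF≡sum : ∀ {m} (f : Vect m) → sumF K f ≡ sum f
  sumF≡sum {zero}  f = refl
  sumF≡sum {suc m} f = cong (f zero +_) (sumF≡sum (f ∘ suc))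

  pair-comm : ∀ {N} (a x : Vect N) → ⟨ a , x ⟩ ≡ ⟨ x , a ⟩
  pair-comm a x = sum-cong-≗ λ k → *-comm (a k) (x k)

  affine⇒indep : ∀ {m} (ι : Fin m → Fin n) → AffinelyIndependent K (V ∘ ι) → Indep (W ∘ ι)
  affine⇒indep ι ind c rel = ind c
    (trans (sumF≡sum c) (trans (sum-cong-≗ λ j → sym (*-identityʳ (c j))) (rel zero)))
    (λ k → trans (sumF≡sum λ j → c j * V (ι j) k) (rel (suc k)))

  indep⇒affine : ∀ {m} (ι : Fin m → Fin n) → Indep (W ∘ ι) → AffinelyIndependent K (V ∘ ι)
  indep⇒affine ι ind c Σc≡0 rel = ind c λ where
    zero    → trans (sum-cong-≗ λ j → *-identityʳ (c j)) (trans (sym (sumF≡sum c)) Σc≡0)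
    (suc k) → trans (sym (sumF≡sum λ j → c j * V (ι j) k)) (rel k)

  -- A lower bound on dimension: the affine hull of `S` has dimension at least `t` - 1.
  AI : Subset n → ℕ → Set
  AI S t = ∃ λ (ι : Fin t → Fin n) → (∀ j → ι j ∈ S) × Indep (W ∘ ι)

  HasDim : Subset n → ℕ → Set
  HasDim S k = AI S (suc k) × ¬ AI S (suc (suc k))

  dim⇒ : ∀ {S k} → HasAffineDim K V S k → HasDim S k
  dim⇒ ((ι , ι∈S , ind) , max) =
    (ι , ι∈S , affine⇒indep ι ind) , λ (κ , κ∈S , ind′) → max (κ , κ∈S , indep⇒affine κ ind′)

  dim⇐ : ∀ {S k} → HasDim S k → HasAffineDim K V S k
  dim⇐ ((ι , ι∈S , ind) , max) =
    (ι , ι∈S , indep⇒affine ι ind) , λ (κ , κ∈S , ind′) → max (κ , κ∈S , affine⇒indep κ ind′)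

  AI-⊆ : ∀ {S T t} → S ⊆ T → AI S t → AI T t
  AI-⊆ S⊆T (ι , ι∈S , ind) = ι , (λ j → S⊆T (ι∈S j)) , ind

  AI-pred : ∀ {S t} → AI S (suc t) → AI S t
  AI-pred (ι , ι∈S , ind) = ι ∘ suc , ι∈S ∘ suc , indep-punchIn {w = W ∘ ι} zero ind

  AI-≤ : ∀ {S s t} → s ℕ.≤′ t → AI S t → AI S s
  AI-≤ ℕ.≤′-refl       ai = ai
  AI-≤ (ℕ.≤′-step s≤t) ai = AI-≤ s≤t (AI-pred ai)

  dim-unique : ∀ {S i j} → HasDim S i → HasDim S j → i ≡ j
  dim-unique {i = i} {j} (ai , nai) (aj , naj) with ℕ.<-cmp i j
  ... | tri< i<j _ _ = contradiction (AI-≤ (ℕ.≤⇒≤′ (s≤s i<j)) aj) nai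
  ... | tri≈ _ i≡j _ = i≡j
  ... | tri> _ _ j<i = contradiction (AI-≤ (ℕ.≤⇒≤′ (s≤s j<i)) ai) naj

  -- The inequality c·x ≤ b becomes the covector (b, -c), an inner normal that is nonnegative on all
  -- points and vanishes exactly on `S`.
  record Supports (a : Vect (suc d)) (S : Subset n) : Set where
    field
      nonneg : ∀ j → 0# ≤ᶠ ⟨ a , W j ⟩
      on     : ∀ {j} → j ∈ S → ⟨ a , W j ⟩ ≡ 0#
      off    : ∀ {j} → ⟨ a , W j ⟩ ≡ 0# → j ∈ S
  open Supports public

  private
    dot-pair : ∀ (c : Point K d) b j →
      ⟨ b ∷ (λ k → - c k) , W j ⟩ ≡ b + - dot K c (V j)
    dot-pair c b j = cong₂ _+_ (*-identityʳ b)
      (trans (pair-neg c (V j)) (cong -_ (sym (sumF≡sum λ k → c k * V j k))))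

  face⇒supports : ∀ {S} → IsFace K V S → ∃ λ a → Supports a S
  face⇒supports (_ , c , b , c≤b , on≡ , off≡) = b ∷ (λ k → - c k) , record
    { nonneg = λ j → subst (0# ≤ᶠ_) (sym (dot-pair c b j)) (x≤y⇒0≤y-x (c≤b j))
    ; on     = λ {j} j∈S → trans (dot-pair c b j) (trans (cong (λ z → b + - z) (on≡ j j∈S)) (-‿inverseʳ b))
    ; off    = λ {j} e → off≡ j (sym (x-y≡0⇒x≡y (trans (sym (dot-pair c b j)) e))) }

  supports⇒face : ∀ {S a} → Nonempty S → Supports a S → IsFace K V S
  supports⇒face {a = a} ne s = ne , (λ k → - a (suc k)) , a zero
    , (λ j → 0≤y-x⇒x≤y (subst (0# ≤ᶠ_) (eq j) (nonneg s j)))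
    , (λ j j∈S → sym (x-y≡0⇒x≡y (trans (sym (eq j)) (on s j∈S))))
    , (λ j e → off s (trans (eq j) (trans (cong (λ z → a zero + - z) e) (-‿inverseʳ _))))
    where
    eq : ∀ j → ⟨ a , W j ⟩ ≡ a zero + - dot K (λ k → - a (suc k)) (V j)
    eq j = begin
      ⟨ a , W j ⟩
        ≡⟨ cong (a zero * 1# +_) (sum-cong-≗ λ k → solve 2 (λ x y → x :* y := :- :- x :* y) refl (a (suc k)) (V j k)) ⟩
      ⟨ a zero ∷ (λ k → - - a (suc k)) , W j ⟩    ≡⟨ dot-pair _ _ j ⟩
      a zero + - dot K (λ k → - a (suc k)) (V j)  ∎

  -- A sum of two nonnegative values vanishes only where both do.
  ∩-supports : ∀ {a b S T} → Supports a S → Supports b T → Supports (λ k → a k + b k) (S ∩ T)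
  ∩-supports {a} {b} {S} {T} s t = record
    { nonneg = λ j → subst (0# ≤ᶠ_) (sym (pair-+ a b (W j))) (+-nonneg (nonneg s j) (nonneg t j))
    ; on     = λ {j} j∈∩ → let (j∈S , j∈T) = x∈p∩q⁻ S T j∈∩ in
        trans (pair-+ a b (W j)) (trans (cong₂ _+_ (on s j∈S) (on t j∈T)) (+-identityˡ 0#))
    ; off    = λ {j} e → let e′ = trans (sym (pair-+ a b (W j))) e in x∈p∩q⁺
        ( off s (+-nonneg-≡0 (nonneg s j) (nonneg t j) e′)
        , off t (+-nonneg-≡0 (nonneg t j) (nonneg s j) (trans (+-comm _ _) e′)) ) }

  AI-extend : ∀ {S T t q} a → (∀ {j} → j ∈ S → ⟨ a , W j ⟩ ≡ 0#) → S ⊆ T →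
    q ∈ T → ⟨ a , W q ⟩ ≢0 → AI S t → AI T (suc t)
  AI-extend {q = q} a aS≡0 S⊆T q∈T aq≢0 (ι , ι∈S , ind) =
    q ∷ ι , (λ { zero → q∈T ; (suc j) → S⊆T (ι∈S j) }) ,
    λ c rel → indep-∷ {w = W ∘ ι} {W q} a ind (λ j → aS≡0 (ι∈S j)) aq≢0 c rel

  pair-combination : ∀ (a b : Vect (suc d)) s x → ⟨ (λ k → a k + s * b k) , x ⟩ ≡ ⟨ a , x ⟩ + s * ⟨ b , x ⟩
  pair-combination a b s x = trans (pair-+ a (λ k → s * b k) x) (cong (⟨ a , x ⟩ +_) (pair-* s b x))

  -- The supporting hyperplane γ of S is tilted in the direction α, which vanishes on S, until it
  -- touches a further point.
  rotate : ∀ {S γ} → Supports γ S → ∀ α → (∀ {j} → j ∈ S → ⟨ α , W j ⟩ ≡ 0#) →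
    ∀ r → ⟨ α , W r ⟩ ≤ᶠ 0# → ⟨ α , W r ⟩ ≢0 →
    ¬ ¬ ∃₂ λ S′ γ′ → Supports γ′ S′ × S ⊆ S′ × (∃ λ r → r ∈ S′ × ⟨ α , W r ⟩ ≢0)
      × (∀ {j} → ⟨ α , W j ⟩ ≡ 0# → j ∈ S′ → j ∈ S)
  rotate {S} {γ} sγ α α≡0 r₀ αr₀≤0 αr₀≢0 = do
    zero? ← ¬¬-dec n (λ j → ⟨ α , W j ⟩ ≡ 0#)
    neg? ← ¬¬-dec n Neg
    -- A ratio test: `ρ` gives the amount of tilt at which a point with negative `α`-value becomes
    -- tight. Stopping at the least such amount keeps every point on the nonnegative side.
    inj₁ (r , neg-r , min) ← return (minimum isTotalOrder n neg? (ρ neg?))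
      where inj₂ none → contradiction (αr₀≤0 , αr₀≢0) (none r₀)
    let
      s = ρ neg? r
      γ′ : Vect (suc d)
      γ′ k = γ k + s * α k
      0≤s : 0# ≤ᶠ s
      0≤s = case ρ-spec neg? r neg-r of λ (0≤s , _) → 0≤s
      nonneg′ : ∀ j → 0# ≤ᶠ ⟨ γ′ , W j ⟩
      nonneg′ j = subst (0# ≤ᶠ_) (sym (pair-combination γ α s (W j))) (case neg? j of λ where
        (yes neg-j) → subst (0# ≤ᶠ_) (gap (proj₂ (ρ-spec neg? j neg-j)))
                        (*-nonneg _ _ (x≤y⇒0≤y-x (min j neg-j)) (neg-nonneg (proj₁ neg-j)))
        (no ¬neg-j) → +-nonneg (nonneg sγ j) (*-nonneg _ _ 0≤s (case zero? j of λ where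
          (yes α≡0) → subst (0# ≤ᶠ_) (sym α≡0) ≤-refl
          (no α≢0)  → case ≤-total 0# ⟨ α , W j ⟩ of λ where
            (inj₁ 0≤α) → 0≤α
            (inj₂ α≤0) → contradiction (α≤0 , α≢0) ¬neg-j)))
      unchanged : ∀ {j} → ⟨ α , W j ⟩ ≡ 0# → ⟨ γ′ , W j ⟩ ≡ ⟨ γ , W j ⟩
      unchanged {j} α≡0 = trans (pair-combination γ α s (W j))
        (trans (cong (λ z → ⟨ γ , W j ⟩ + s * z) α≡0) (solve 2 (λ x s → x :+ s :* con ℤ.+0 := x) refl _ s))
    γ′≡0? ← ¬¬-dec n (λ j → ⟨ γ′ , W j ⟩ ≡ 0#)
    let (S′ , to , from) = subsetOf γ′≡0?
    return (S′ , γ′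
      , record { nonneg = nonneg′ ; on = λ {j} → to j ; off = λ {j} → from j }
      , (λ {j} j∈S → from j (trans (unchanged (α≡0 j∈S)) (on sγ j∈S)))
      , (r , from r (trans (pair-combination γ α s (W r)) (tight (proj₂ (ρ-spec neg? r neg-r)))) , proj₂ neg-r)
      , (λ {j} α≡0 j∈S′ → off sγ (trans (sym (unchanged α≡0)) (to j j∈S′))))
    where
    Neg : Fin n → Set
    Neg j = ⟨ α , W j ⟩ ≤ᶠ 0# × ⟨ α , W j ⟩ ≢0
    neg≢0 : ∀ {x} → x ≢0 → - x ≢0
    neg≢0 x≢0 -x≡0 = x≢0 (neg-zero⁻¹ -x≡0)
    ρ : (∀ j → Dec (Neg j)) → Fin n → Carrier
    ρ neg? j with neg? j
    ... | yes (_ , α≢0) = ⟨ γ , W j ⟩ * proj₁ (inverse _ (neg≢0 α≢0))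
    ... | no _          = 0#
    ρ-spec : ∀ neg? j → Neg j → 0# ≤ᶠ ρ neg? j × ⟨ γ , W j ⟩ ≡ ρ neg? j * - ⟨ α , W j ⟩
    ρ-spec neg? j neg with neg? j
    ... | no ¬neg = contradiction neg ¬neg
    ... | yes (α≤0 , α≢0) with inverse _ (neg≢0 α≢0)
    ...   | y , xy≡1 = *-nonneg _ _ (nonneg sγ j) (inverse-nonneg (neg-nonneg α≤0) xy≡1) , (begin
      ⟨ γ , W j ⟩            ≡⟨ *-identityʳ _ ⟨
      ⟨ γ , W j ⟩ * 1#       ≡⟨ cong (⟨ γ , W j ⟩ *_) xy≡1 ⟨
      ⟨ γ , W j ⟩ * (- ⟨ α , W j ⟩ * y)  ≡⟨ solve 3 (λ g x y → g :* (x :* y) := g :* y :* x) refl _ _ _ ⟩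
      ⟨ γ , W j ⟩ * y * - ⟨ α , W j ⟩    ∎)
    gap : ∀ {g t s a} → g ≡ t * - a → (t + - s) * - a ≡ g + s * a
    gap {t = t} {s} {a} refl = solve 3 (λ t s a → (t :+ :- s) :* :- a := t :* :- a :+ s :* a) refl t s a
    tight : ∀ {g s a} → g ≡ s * - a → g + s * a ≡ 0#
    tight {s = s} {a} refl = solve 2 (λ s a → s :* :- a :+ s :* a := con ℤ.+0) refl s a

  indep-distinct : ∀ {m N} {w : Fin m → Vect N} {i j} → Indep w → (∀ k → w i k ≡ w j k) → i ≢ j → ⊥
  indep-distinct {suc m} {w = w} {i} {j} ind wi≡wj i≢j =
    0≢1 (trans (sym (ind c rel i)) cᵢ≡1)
    where
    c : Vect (suc m)
    c k with k Fin.≟ i | k Fin.≟ j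
    ... | yes _ | _     = 1#
    ... | no _  | yes _ = - 1#
    ... | no _  | no _  = 0#
    cᵢ≡1 : c i ≡ 1#
    cᵢ≡1 with i Fin.≟ i
    ... | yes _  = refl
    ... | no i≢i = contradiction refl i≢i
    cⱼ≡-1 : c j ≡ - 1#
    cⱼ≡-1 with j Fin.≟ i | j Fin.≟ j
    ... | yes j≡i | _      = contradiction (sym j≡i) i≢j
    ... | no _    | yes _  = refl
    ... | no _    | no j≢j = contradiction refl j≢j
    c≡0 : ∀ k → k ≢ i → k ≢ j → c k ≡ 0#
    c≡0 k k≢i k≢j with k Fin.≟ i | k Fin.≟ j
    ... | yes k≡i | _       = contradiction k≡i k≢i
    ... | no _    | yes k≡j = contradiction k≡j k≢j
    ... | no _    | no _    = refl
    rel : ∀ l → comb c w l ≡ 0#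
    rel l = begin
      comb c w l
        ≡⟨ sum-remove {i = i} (λ k → c k * w k l) ⟩
      c i * w i l + sum (λ k → c (punchIn i k) * w (punchIn i k) l)
        ≡⟨ cong (c i * w i l +_) (sum-single _ (punchOut i≢j) λ k k≢ → trans
             (cong (_* w (punchIn i k) l) (c≡0 _ (Fin.punchInᵢ≢i i k) λ e →
               k≢ (Fin.punchIn-injective i _ _ (trans e (sym (Fin.punchIn-punchOut i≢j))))))
             (zeroˡ _)) ⟩
      c i * w i l + c (punchIn i (punchOut i≢j)) * w (punchIn i (punchOut i≢j)) l
        ≡⟨ cong (λ k → c i * w i l + c k * w k l) (Fin.punchIn-punchOut i≢j) ⟩
      c i * w i l + c j * w j l
        ≡⟨ cong₂ _+_ (cong₂ _*_ cᵢ≡1 (wi≡wj l)) (cong (_* w j l) cⱼ≡-1) ⟩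
      1# * w j l + - 1# * w j l
        ≡⟨ solve 2 (λ x y → x :* y :+ :- x :* y := con ℤ.+0) refl 1# (w j l) ⟩
      0# ∎

  -- Existence of facets in a full-dimensional polytope

  module Full (dim-V : HasAffineDim K V ⊤ d) where

    AI-top : AI ⊤ (suc d)
    AI-top = proj₁ (dim⇒ dim-V)

    ¬AI-top : ¬ AI ⊤ (suc (suc d))
    ¬AI-top = proj₂ (dim⇒ dim-V)

    ⊆⊤ : ∀ {S : Subset n} → S ⊆ ⊤
    ⊆⊤ _ = ∈⊤

    proper⇒¬AI : ∀ {S a q} → Supports a S → q ∉ S → ¬ AI S (suc d)
    proper⇒¬AI {a = a} s q∉S ai = ¬AI-top (AI-extend a (on s) ⊆⊤ ∈⊤ (q∉S ∘ off s) ai)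

    ¬AI⇒proper : ∀ {S} → ¬ AI S (suc d) → ∃ λ q → q ∉ S
    ¬AI⇒proper {S} ¬ai with Fin.all? (_∈? S)
    ... | yes all = contradiction (AI-⊆ {⊤} (λ {j} _ → all j) AI-top) ¬ai
    ... | no ¬all = Fin.¬∀⟶∃¬ n _ (_∈? S) ¬all

    record Facet (F : Subset n) : Set where
      field
        normal   : Vect (suc d)
        supports : Supports normal F
        rank     : AI F d
        ¬full    : ¬ AI F (suc d)
    open Facet public

    -- `S` together with `q` has rank at most `d` in a space of dimension 1 + d, so a nonzero
    -- covector vanishes on both. It is nonzero at some point since the points span, and its sign
    -- may be chosen. Vanishing at `q` keeps `q` off the face when the hyperplane is tilted.
    direction : ∀ {S q} → ¬ AI S d → q ∉ S → ¬ ¬ ∃ λ α → (∀ {j} → j ∈ S → ⟨ α , W j ⟩ ≡ 0#) ×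
      ⟨ α , W q ⟩ ≡ 0# × (∃ λ r → ⟨ α , W r ⟩ ≤ᶠ 0# × ⟨ α , W r ⟩ ≢0)
    direction {S} {q} ¬ai q∉S = do
      inj₁ (c , (k , ck≢0) , ker) ← rank-alternative (suc d) n (W ∘ g)
        where inj₂ (_ , ι , ind) → contradiction (drop ι ind) ¬ai
      let c≡0 : ∀ j → ⟨ c , W (g j) ⟩ ≡ 0#
          c≡0 j = trans (pair-comm c (W (g j))) (ker j)
          cS≡0 : ∀ {j} → j ∈ S → ⟨ c , W j ⟩ ≡ 0#
          cS≡0 {j} j∈S = subst (λ j → ⟨ c , W j ⟩ ≡ 0#) (g-in j∈S) (c≡0 j)
          cq≡0 : ⟨ c , W q ⟩ ≡ 0#
          cq≡0 = subst (λ j → ⟨ c , W j ⟩ ≡ 0#) (g-out q∉S) (c≡0 q)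
      zero? ← ¬¬-dec n (λ j → ⟨ c , W j ⟩ ≡ 0#)
      no ¬all ← return (Fin.all? zero?)
        where yes all → λ _ → let (ι , _ , ind) = AI-top in
                          indep-full (W ∘ ι) ind c (all ∘ ι) k ck≢0
      let (r , cr≢0) = Fin.¬∀⟶∃¬ n _ zero? ¬all
      inj₂ 0≤cr ← return (≤-total ⟨ c , W r ⟩ 0#)
        where inj₁ cr≤0 → return (c , (λ {j} → cS≡0 {j}) , cq≡0 , r , cr≤0 , cr≢0)
      return ((λ k → - c k)
        , (λ {j} j∈S → neg≡0 c j (cS≡0 j∈S)) , neg≡0 c q cq≡0 , r
        , subst₂ _≤ᶠ_ (trans (+-identityˡ _) (sym (pair-neg c (W r)))) (-‿inverseʳ _)
            (+-mono 0# _ (- ⟨ c , W r ⟩) 0≤cr)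
        , λ e → cr≢0 (neg-zero⁻¹ (trans (sym (pair-neg c (W r))) e)))
      where
      neg≡0 : ∀ c j → ⟨ c , W j ⟩ ≡ 0# → ⟨ (λ k → - c k) , W j ⟩ ≡ 0#
      neg≡0 c j e = trans (pair-neg c (W j)) (neg-zero e)
      -- Sending all points outside `S` to `q` makes the rows exactly those of `S` and `q`. Of 1 + d
      -- independent rows at most one is `q`, and dropping it would leave `d` in `S`.
      g : Fin n → Fin n
      g j with j ∈? S
      ... | yes _ = j
      ... | no _  = q
      g-in : ∀ {j} → j ∈ S → g j ≡ j
      g-in {j} j∈S with j ∈? S
      ... | yes _  = refl
      ... | no j∉S = contradiction j∈S j∉S
      g-out : ∀ {j} → j ∉ S → g j ≡ q
      g-out {j} j∉S with j ∈? S
      ... | yes j∈S = contradiction j∈S j∉S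
      ... | no _    = refl
      in-or-q : ∀ j → g j ∈ S ⊎ g j ≡ q
      in-or-q j with j ∈? S
      ... | yes j∈S = inj₁ j∈S
      ... | no _    = inj₂ refl
      drop : (ι : Fin (suc d) → Fin n) → Indep (W ∘ g ∘ ι) → AI S d
      drop ι ind with Fin.any? (λ k → ¬? (g (ι k) ∈? S))
      ... | no all = AI-pred (g ∘ ι , (λ k → case g (ι k) ∈? S of λ where
                (yes ∈S) → ∈S
                (no ∉S)  → contradiction (k , ∉S) all) , ind)
      ... | yes (k , k∉S) = g ∘ ι ∘ punchIn k
        , (λ l → case in-or-q (ι (punchIn k l)) of λ where
             (inj₁ ∈S) → ∈S
             (inj₂ ≡q) → ⊥-elim (indep-distinct {w = W ∘ g ∘ ι} ind
               (λ i → cong (λ z → W z i) (trans ≡q (sym (case in-or-q (ι k) of λ where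
                 (inj₁ ∈S)  → contradiction ∈S k∉S
                 (inj₂ ≡q′) → ≡q′))))
               (Fin.punchInᵢ≢i k l)))
        , indep-punchIn {w = W ∘ g ∘ ι} k ind

    Above : Subset n → Set
    Above S = ∃ λ F → Facet F × S ⊆ F

    -- As long as the rank of the face is below `d`, tilting its hyperplane about the face and an
    -- outside point `q` adds a point while `q` stays outside, so the face remains proper. Its
    -- cardinality bounds the number of tilts.
    facet-above : ∀ {S a} → Supports a S → ¬ AI S (suc d) → ¬ ¬ Above S
    facet-above {S} = go n (ℕ.m≤m+n n ∣ S ∣)
      where
      go : ∀ fuel {S a} → n ℕ.≤ fuel ℕ.+ ∣ S ∣ → Supports a S → ¬ AI S (suc d) →
        ¬ ¬ Above S
      go fuel {S} {a} bound s ¬full = do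
        no ¬rank ← ¬¬-excluded-middle {A = AI S d}
          where yes rank → return {A = Above S} (S , record { supports = s ; rank = rank ; ¬full = ¬full } , id)
        let (q , q∉S) = ¬AI⇒proper ¬full
        (α , αS≡0 , αq≡0 , r , αr≤0 , αr≢0) ← direction ¬rank q∉S
        (S′ , a′ , s′ , S⊆S′ , (r , r∈S′ , αr≢0) , keep) ← rotate s α αS≡0 r αr≤0 αr≢0
        let q∉S′ = q∉S ∘ keep αq≡0
            S<S′ = p⊂q⇒∣p∣<∣q∣ (S⊆S′ , r , r∈S′ , αr≢0 ∘ αS≡0)
        (F , facet , S′⊆F) ← continue fuel bound S<S′ s′ (proper⇒¬AI s′ q∉S′)
        return {A = Above S} (F , facet , λ j∈S → S′⊆F (S⊆S′ j∈S))
        where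
        continue : ∀ fuel {S′ a′} → n ℕ.≤ fuel ℕ.+ ∣ S ∣ → ∣ S ∣ ℕ.< ∣ S′ ∣ → Supports a′ S′ →
          ¬ AI S′ (suc d) → ¬ ¬ Above S′
        continue zero {S′} n≤S S<S′ _ _ =
          contradiction (ℕ.≤-trans S<S′ (ℕ.≤-trans (∣p∣≤n S′) n≤S)) (ℕ.<-irrefl refl)
        continue (suc fuel) bound S<S′ s′ ¬full′ =
          go fuel (ℕ.≤-trans bound (ℕ.≤-trans (ℕ.≤-reflexive (sym (ℕ.+-suc fuel _))) (ℕ.+-monoʳ-≤ fuel S<S′))) s′ ¬full′

    -- The hyperplane of the ridge `G` is tilted along the negated normal of `F`, which vanishes on
    -- `F` and is negative off it. The new face gains a point off `F`, hence has full facet rank and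
    -- differs from `F`; it still misses `s`, hence is proper.
    other-facet : ∀ {F G γ t} → d ≡ suc t → Facet F → Supports γ G → G ⊆ F → AI G t →
      (∃ λ s → s ∈ F × s ∉ G) → ¬ ¬ ∃ λ F′ → Facet F′ × G ⊆ F′ × ¬ F′ ≡ F
    other-facet {F} {G} {γ} {t} d≡1+t facet sγ G⊆F rankG (s , s∈F , s∉G) = do
      let (q , q∉F) = ¬AI⇒proper (¬full facet)
      (F′ , a′ , s′ , G⊆F′ , (r , r∈F′ , αr≢0) , keep) ← rotate sγ α
        (λ j∈G → α≡0 (G⊆F j∈G)) q
        (subst₂ _≤ᶠ_ (trans (+-identityˡ _) (sym (pair-neg a (W q)))) (-‿inverseʳ _)
           (+-mono 0# _ (- ⟨ a , W q ⟩) (nonneg (supports facet) q)))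
        (λ e → q∉F (off (supports facet) (α≡0⇒a≡0 e)))
      return {A = ∃ λ F′ → Facet F′ × G ⊆ F′ × ¬ F′ ≡ F} (F′ , record
        { supports = s′
        ; rank     = subst (AI F′) (sym d≡1+t)
                       (AI-extend α (λ j∈G → α≡0 (G⊆F j∈G)) G⊆F′ r∈F′ αr≢0 rankG)
        ; ¬full    = proper⇒¬AI s′ (s∉G ∘ keep (α≡0 s∈F)) }
        , G⊆F′ , λ { refl → αr≢0 (α≡0 r∈F′) })
      where
      a α : Vect (suc d)
      a = normal facet
      α k = - a k
      α≡0 : ∀ {j} → j ∈ F → ⟨ α , W j ⟩ ≡ 0#
      α≡0 {j} j∈F = trans (pair-neg a (W j)) (neg-zero (on (supports facet) j∈F))
      α≡0⇒a≡0 : ∀ {j} → ⟨ α , W j ⟩ ≡ 0# → ⟨ a , W j ⟩ ≡ 0#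
      α≡0⇒a≡0 {j} e = neg-zero⁻¹ (trans (sym (pair-neg a (W j))) e)

    -- A positive multiple of the barycentre. The value of a covector here is the sum of its values
    -- at all points, so it is positive for the normal of a proper face and can be scaled to 1.
    β : Vect (suc d)
    β = comb (λ _ → 1#) W

    normalize : ∀ {F a q} → Supports a F → q ∉ F → ∃ λ a′ → Supports a′ F × ⟨ a′ , β ⟩ ≡ 1#
    normalize {F} {a} {q} s q∉F = a′ , record
      { nonneg = λ j → subst (0# ≤ᶠ_) (sym (pair-* y a (W j)))
                         (*-nonneg _ _ (inverse-nonneg 0≤σ σy≡1) (nonneg s j))
      ; on     = λ {j} j∈F → trans (pair-* y a (W j)) (trans (cong (y *_) (on s j∈F)) (zeroʳ y))
      ; off    = λ {j} e → off s (cancel y≢0 (trans (sym (pair-* y a (W j))) e)) }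
      , trans (pair-* y a β) (trans (*-comm y _) (trans (cong (_* y) aβ≡σ) σy≡1))
      where
      σ : Carrier
      σ = sum λ j → ⟨ a , W j ⟩
      0≤σ : 0# ≤ᶠ σ
      0≤σ = sum-nonneg _ (nonneg s)
      σ≢0 : σ ≢0
      σ≢0 σ≡0 = q∉F (off s (sum-nonneg-≡0 _ (nonneg s) σ≡0 q))
      y : Carrier
      y = proj₁ (inverse σ σ≢0)
      σy≡1 : σ * y ≡ 1#
      σy≡1 = proj₂ (inverse σ σ≢0)
      y≢0 : y ≢0
      y≢0 y≡0 = 0≢1 (trans (sym (zeroʳ σ)) (trans (cong (σ *_) (sym y≡0)) σy≡1))
      a′ : Vect (suc d)
      a′ k = y * a k
      aβ≡σ : ⟨ a , β ⟩ ≡ σ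
      aβ≡σ = trans (pair-comb a (λ _ → 1#) W) (sum-cong-≗ λ j → *-identityˡ ⟨ a , W j ⟩)

-- The lexicographic order as a cone

module Lexicographic (K : OrderedField) where
  open Linear K
  open ≡-Reasoning

  -- All that the local-to-global argument asks of an order, so that it applies to the lexicographic
  -- cone and to its negative. Scaling is doubly negated because it must distinguish zero factors
  -- from positive ones.
  record Cone (N : ℕ) : Set₁ where
    field
      Pos   : Vect N → Set
      pos-resp  : ∀ {x y} → (∀ k → x k ≡ y k) → Pos x → Pos y
      zero′ : Pos (λ _ → 0#)
      plus  : ∀ {x y} → Pos x → Pos y → Pos (λ k → x k + y k)
      scale : ∀ {s x} → 0# ≤ᶠ s → Pos x → ¬ ¬ Pos (λ k → s * x k)

    sum-pos : ∀ {m} (x : Fin m → Vect N) → (∀ i → Pos (x i)) → Pos (λ k → sum λ i → x i k)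
    sum-pos {zero}  x h = zero′
    sum-pos {suc m} x h = plus (h zero) (sum-pos (x ∘ suc) (h ∘ suc))

  -- The first nonzero coordinate, if any, is positive. Membership carries the information which
  -- leading coordinates vanish, as this cannot be decided.
  Lex : ∀ {N} → Vect N → Set
  Lex {zero}  x = Unit.⊤
  Lex {suc N} x = (0# ≤ᶠ x zero × x zero ≢0) ⊎ (x zero ≡ 0# × Lex (x ∘ suc))

  lex-resp : ∀ {N} {x y : Vect N} → (∀ k → x k ≡ y k) → Lex x → Lex y
  lex-resp {zero}  x≡y _ = _
  lex-resp {suc N} x≡y (inj₁ (0≤x , x≢0)) =
    inj₁ (subst (0# ≤ᶠ_) (x≡y zero) 0≤x , x≢0 ∘ trans (x≡y zero))
  lex-resp {suc N} x≡y (inj₂ (x≡0 , l)) = inj₂ (trans (sym (x≡y zero)) x≡0 , lex-resp (x≡y ∘ suc) l)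

  lex-zero : ∀ {N} → Lex {N} (λ _ → 0#)
  lex-zero {zero}  = _
  lex-zero {suc N} = inj₂ (refl , lex-zero)

  lex-+ : ∀ {N} {x y : Vect N} → Lex x → Lex y → Lex (λ k → x k + y k)
  lex-+ {zero} _ _ = _
  lex-+ {suc N} (inj₁ (0≤x , x≢0)) (inj₁ (0≤y , _)) =
    inj₁ (+-nonneg 0≤x 0≤y , x≢0 ∘ +-nonneg-≡0 0≤x 0≤y)
  lex-+ {suc N} {x} (inj₁ (0≤x , x≢0)) (inj₂ (y≡0 , _)) =
    inj₁ (subst (0# ≤ᶠ_) eq 0≤x , x≢0 ∘ trans eq)
    where eq = sym (trans (cong (x zero +_) y≡0) (+-identityʳ _))
  lex-+ {suc N} {x} {y} (inj₂ (x≡0 , _)) (inj₁ (0≤y , y≢0)) =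
    inj₁ (subst (0# ≤ᶠ_) eq 0≤y , y≢0 ∘ trans eq)
    where eq = sym (trans (cong (_+ y zero) x≡0) (+-identityˡ _))
  lex-+ {suc N} (inj₂ (x≡0 , l)) (inj₂ (y≡0 , l′)) =
    inj₂ (trans (cong₂ _+_ x≡0 y≡0) (+-identityˡ 0#) , lex-+ l l′)

  lex-* : ∀ {N s} {x : Vect N} → 0# ≤ᶠ s → s ≢0 → Lex x → Lex (λ k → s * x k)
  lex-* {zero} _ _ _ = _
  lex-* {suc N} 0≤s s≢0 (inj₁ (0≤x , x≢0)) = inj₁ (*-nonneg _ _ 0≤s 0≤x , x≢0 ∘ cancel s≢0)
  lex-* {suc N} {s} 0≤s s≢0 (inj₂ (x≡0 , l)) =
    inj₂ (trans (cong (s *_) x≡0) (zeroʳ s) , lex-* 0≤s s≢0 l)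

  nonneg-antisym : ∀ {x} → 0# ≤ᶠ x → 0# ≤ᶠ - x → x ≡ 0#
  nonneg-antisym {x} 0≤x 0≤-x = +-nonneg-≡0 0≤x 0≤-x (-‿inverseʳ x)

  lex-total : ∀ {N} (x : Vect N) → ¬ ¬ (Lex x ⊎ Lex (λ k → - x k))
  lex-total {zero}  x = return (inj₁ _)
  lex-total {suc N} x = do
    no x≢0 ← ¬¬-excluded-middle {A = x zero ≡ 0#}
      where yes x≡0 → do
              inj₁ l ← lex-total (x ∘ suc)
                where inj₂ l → return (inj₂ (inj₂ (neg-zero x≡0 , l)))
              return (inj₁ (inj₂ (x≡0 , l)))
    return (case ≤-total 0# (x zero) of λ where
      (inj₁ 0≤x) → inj₁ (inj₁ (0≤x , x≢0))
      (inj₂ x≤0) → inj₂ (inj₁ (neg-nonneg x≤0 , x≢0 ∘ neg-zero⁻¹)))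

  lex-antisym : ∀ {N} {x : Vect N} → Lex x → Lex (λ k → - x k) → ∀ k → x k ≡ 0#
  lex-antisym {suc N} (inj₁ (0≤x , x≢0)) (inj₁ (0≤-x , _)) k = contradiction (nonneg-antisym 0≤x 0≤-x) x≢0
  lex-antisym {suc N} (inj₁ (_ , x≢0)) (inj₂ (-x≡0 , _)) k = contradiction (neg-zero⁻¹ -x≡0) x≢0
  lex-antisym {suc N} (inj₂ (x≡0 , _)) (inj₁ (_ , -x≢0)) k = contradiction (neg-zero x≡0) -x≢0
  lex-antisym {suc N} (inj₂ (x≡0 , l)) (inj₂ (_ , l′)) = λ { zero → x≡0 ; (suc k) → lex-antisym l l′ k }

  lexCone : ∀ N → Cone N
  lexCone N = record
    { Pos = Lex ; pos-resp = lex-resp ; zero′ = lex-zero ; plus = lex-+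
    ; scale = λ {s} {x} 0≤s l → do
        no s≢0 ← ¬¬-excluded-middle {A = s ≡ 0#}
          where yes s≡0 → return (lex-resp (λ k → sym (trans (cong (_* x k) s≡0) (zeroˡ (x k)))) lex-zero)
        return (lex-* 0≤s s≢0 l) }

  opposite : ∀ {N} → Cone N → Cone N
  opposite C = record
    { Pos   = λ x → Pos (λ k → - x k)
    ; pos-resp  = λ e → pos-resp (λ k → cong -_ (e k))
    ; zero′ = pos-resp (λ k → sym (neg-zero refl)) zero′
    ; plus  = λ {x} {y} p q → pos-resp (λ k → solve 2 (λ x y → :- x :+ :- y := :- (x :+ y)) refl (x k) (y k)) (plus p q)
    ; scale = λ {s} {x} 0≤s p → do
        q ← scale 0≤s p
        return (pos-resp (λ k → solve 2 (λ s x → s :* :- x := :- (s :* x)) refl s (x k)) q) }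
    where
    open Cone C

-- From the neighbours of a facet to all facets through a face

module LocalCone (K : OrderedField) {m n : ℕ} (V : Fin n → Point K (suc m))
  (dim-V : HasAffineDim K V ⊤ (suc m)) where
  open Linear K
  open import Data.Vec.Functional using (_∷_)
  open Lexicographic K
  open Geometry K V
  open Full dim-V
  open ≡-Reasoning

  Normal : Vect (2 ℕ.+ m) → Set
  Normal a = ⟨ a , β ⟩ ≡ 1#

  diff : Vect (2 ℕ.+ m) → Vect (2 ℕ.+ m) → Vect (2 ℕ.+ m)
  diff b a k = b k + - a k

  pair-diff : ∀ b a x → ⟨ diff b a , x ⟩ ≡ ⟨ b , x ⟩ + - ⟨ a , x ⟩
  pair-diff b a x = trans (pair-+ b (λ k → - a k) x) (cong (⟨ b , x ⟩ +_) (pair-neg a x))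

  -- The local structure of a facet with normal a at a vertex v: p i are the neighbours of v in the
  -- facet, and γ i supports the ridge spanned by v and the p j with j ≢ i.
  module _ {a : Vect (2 ℕ.+ m)} (aβ≡1 : Normal a) (v : Fin n) (p : Fin m → Fin n)
    (γ : Fin m → Vect (2 ℕ.+ m))
    (av≡0 : ⟨ a , W v ⟩ ≡ 0#) (ap≡0 : ∀ i → ⟨ a , W (p i) ⟩ ≡ 0#)
    (γv≡0 : ∀ i → ⟨ γ i , W v ⟩ ≡ 0#) (γp≡0 : ∀ i j → j ≢ i → ⟨ γ i , W (p j) ⟩ ≡ 0#)
    (γp≢0 : ∀ i → ⟨ γ i , W (p i) ⟩ ≢0) where

    -- `β`, `v` and the `p i` form a basis: the `γ i` make `v` and the `p i` independent, and `a`
    -- vanishes on all of these but not at `β`.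
    vanish : ∀ b → ⟨ b , β ⟩ ≡ 0# → ⟨ b , W v ⟩ ≡ 0# → (∀ i → ⟨ b , W (p i) ⟩ ≡ 0#) →
      ¬ ¬ (∀ k → b k ≡ 0#)
    vanish b bβ≡0 bv≡0 bp≡0 = ¬¬-Π _ (indep-full (β ∷ (W v ∷ (W ∘ p)))
      (indep-∷ {w = W v ∷ (W ∘ p)} {β} a (indep-dual {w = W ∘ p} {W v} zero γ (0≢1 ∘ sym) γv≡0 γp≡0 γp≢0)
        (λ { zero → av≡0 ; (suc i) → ap≡0 i }) (λ e → 0≢1 (trans (sym e) aβ≡1)))
      b λ { zero → bβ≡0 ; (suc zero) → bv≡0 ; (suc (suc i)) → bp≡0 i })

    normal-unique : ∀ {b} → Normal b → ⟨ b , W v ⟩ ≡ 0# → (∀ i → ⟨ b , W (p i) ⟩ ≡ 0#) →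
      ¬ ¬ (∀ k → b k ≡ a k)
    normal-unique {b} bβ≡1 bv≡0 bp≡0 = do
      b-a≡0 ← vanish (diff b a) (eq β (trans bβ≡1 (sym aβ≡1))) (eq (W v) (trans bv≡0 (sym av≡0)))
        (λ i → eq (W (p i)) (trans (bp≡0 i) (sym (ap≡0 i))))
      return λ k → x-y≡0⇒x≡y (b-a≡0 k)
      where
      eq : ∀ x → ⟨ b , x ⟩ ≡ ⟨ a , x ⟩ → ⟨ diff b a , x ⟩ ≡ 0#
      eq x e = trans (pair-diff b a x) (trans (cong (_+ - ⟨ a , x ⟩) e) (-‿inverseʳ _))

    module _ (C : Cone (2 ℕ.+ m)) where
      open Cone C

      -- The summand of `diff b a` in direction `i`: of the values on the basis it keeps only the
      -- one at `p i`, where `b` and `diff b a` agree because `a` vanishes.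
      Term : Vect (2 ℕ.+ m) → Fin m → Set
      Term b i = ∃ λ t → Pos t × ⟨ t , β ⟩ ≡ 0# × ⟨ t , W v ⟩ ≡ 0# ×
        (∀ j → j ≢ i → ⟨ t , W (p j) ⟩ ≡ 0#) × ⟨ t , W (p i) ⟩ ≡ ⟨ b , W (p i) ⟩

      Better : Fin m → Set
      Better i = ∃ λ c → Normal c × (∀ j → 0# ≤ᶠ ⟨ c , W j ⟩) × ⟨ c , W v ⟩ ≡ 0# ×
        (∀ j → j ≢ i → ⟨ c , W (p j) ⟩ ≡ 0#) × ⟨ c , W (p i) ⟩ ≢0 × Pos (diff c a)

      term : ∀ b → (∀ j → 0# ≤ᶠ ⟨ b , W j ⟩) → ∀ i → ⟨ b , W (p i) ⟩ ≡ 0# ⊎ Better i → ¬ ¬ Term b i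
      term b b≥0 i (inj₁ bp≡0) = return ((λ _ → 0#) , zero′
        , pair-zeroˡ β , pair-zeroˡ (W v) , (λ j _ → pair-zeroˡ (W (p j)))
        , trans (pair-zeroˡ (W (p i))) (sym bp≡0))
      term b b≥0 i (inj₂ (c , cβ≡1 , c≥0 , cv≡0 , cp≡0 , cp≢0 , c-a)) = do
        let (y , xy≡1) = inverse _ cp≢0
            -- The quotient of the values of `b` and `c` at `p i`. It is nonnegative, and it makes
            -- the multiple of `diff c a` agree with `b` there, since `a` vanishes at `p i`.
            s = ⟨ b , W (p i) ⟩ * y
            t : Vect (2 ℕ.+ m)
            t k = s * diff c a k
            t≡0 : ∀ x → ⟨ c , x ⟩ ≡ ⟨ a , x ⟩ → ⟨ t , x ⟩ ≡ 0#
            t≡0 x e = trans (pair-* s (diff c a) x) (trans (cong (s *_) (trans (pair-diff c a x)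
              (trans (cong (_+ - ⟨ a , x ⟩) e) (-‿inverseʳ _)))) (zeroʳ s))
        pos ← scale (*-nonneg _ _ (b≥0 (p i)) (inverse-nonneg (c≥0 (p i)) xy≡1)) c-a
        return (t , pos , t≡0 β (trans cβ≡1 (sym aβ≡1)) , t≡0 (W v) (trans cv≡0 (sym av≡0))
          , (λ j j≢i → t≡0 (W (p j)) (trans (cp≡0 j j≢i) (sym (ap≡0 j)))) , (begin
          ⟨ t , W (p i) ⟩                  ≡⟨ pair-* s (diff c a) (W (p i)) ⟩
          s * ⟨ diff c a , W (p i) ⟩       ≡⟨ cong (s *_) (pair-diff c a (W (p i))) ⟩
          s * (⟨ c , W (p i) ⟩ + - ⟨ a , W (p i) ⟩)
            ≡⟨ cong (λ z → s * (⟨ c , W (p i) ⟩ + - z)) (ap≡0 i) ⟩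
          s * (⟨ c , W (p i) ⟩ + - 0#)
            ≡⟨ solve 3 (λ b y c → (b :* y) :* (c :+ :- con ℤ.+0) := b :* (c :* y)) refl ⟨ b , W (p i) ⟩ y ⟨ c , W (p i) ⟩ ⟩
          ⟨ b , W (p i) ⟩ * (⟨ c , W (p i) ⟩ * y)  ≡⟨ cong (⟨ b , W (p i) ⟩ *_) xy≡1 ⟩
          ⟨ b , W (p i) ⟩ * 1#             ≡⟨ *-identityʳ _ ⟩
          ⟨ b , W (p i) ⟩ ∎))

      pair-sum : ∀ {l} (t : Fin l → Vect (2 ℕ.+ m)) x →
        ⟨ (λ k → sum λ i → t i k) , x ⟩ ≡ sum λ i → ⟨ t i , x ⟩
      pair-sum t x = begin
        ⟨ (λ k → sum λ i → t i k) , x ⟩    ≡⟨ pair-comm (λ k → sum λ i → t i k) x ⟩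
        ⟨ x , (λ k → sum λ i → t i k) ⟩
          ≡⟨ sum-cong-≗ (λ k → cong (x k *_) (sum-cong-≗ λ i → sym (*-identityˡ (t i k)))) ⟩
        ⟨ x , comb (λ _ → 1#) t ⟩          ≡⟨ pair-comb x (λ _ → 1#) t ⟩
        sum (λ i → 1# * ⟨ x , t i ⟩)
          ≡⟨ sum-cong-≗ (λ i → trans (*-identityˡ ⟨ x , t i ⟩) (pair-comm x (t i))) ⟩
        sum (λ i → ⟨ t i , x ⟩) ∎

      -- b - a is the sum of the terms, as one sees on the basis β, v, p.
      local⇒global : ∀ {b} → Normal b → (∀ j → 0# ≤ᶠ ⟨ b , W j ⟩) → ⟨ b , W v ⟩ ≡ 0# →
        (∀ i → ⟨ b , W (p i) ⟩ ≡ 0# ⊎ Better i) → ¬ ¬ Pos (diff b a)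
      local⇒global {b} bβ≡1 b≥0 bv≡0 better = do
        terms ← ¬¬-Π m (λ i → term b b≥0 i (better i))
        let t : Fin m → Vect (2 ℕ.+ m)
            t i = proj₁ (terms i)
            T : Vect (2 ℕ.+ m)
            T k = sum λ i → t i k
            D : Vect (2 ℕ.+ m)
            D = diff (diff b a) T
            D≡0 : ∀ x → ⟨ b , x ⟩ ≡ ⟨ a , x ⟩ → (∀ i → ⟨ t i , x ⟩ ≡ 0#) → ⟨ D , x ⟩ ≡ 0#
            D≡0 x e t≡0 = begin
              ⟨ D , x ⟩                              ≡⟨ pair-diff (diff b a) T x ⟩
              ⟨ diff b a , x ⟩ + - ⟨ T , x ⟩
                ≡⟨ cong₂ (λ y z → y + - z) (pair-diff b a x) (trans (pair-sum t x) (sum-zero t≡0)) ⟩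
              (⟨ b , x ⟩ + - ⟨ a , x ⟩) + - 0#        ≡⟨ cong (λ z → (z + - ⟨ a , x ⟩) + - 0#) e ⟩
              (⟨ a , x ⟩ + - ⟨ a , x ⟩) + - 0#
                ≡⟨ solve 1 (λ x → (x :+ :- x) :+ :- con ℤ.+0 := con ℤ.+0) refl _ ⟩
              0# ∎
            D≡0-p : ∀ i → ⟨ D , W (p i) ⟩ ≡ 0#
            D≡0-p i = begin
              ⟨ D , W (p i) ⟩                            ≡⟨ pair-diff (diff b a) T (W (p i)) ⟩
              ⟨ diff b a , W (p i) ⟩ + - ⟨ T , W (p i) ⟩
                ≡⟨ cong₂ (λ y z → y + - z) (pair-diff b a (W (p i))) (begin
                     ⟨ T , W (p i) ⟩                 ≡⟨ pair-sum t (W (p i)) ⟩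
                     sum (λ j → ⟨ t j , W (p i) ⟩)
                       ≡⟨ sum-single _ i (λ j j≢i → let (_ , _ , _ , _ , tp≡0 , _) = terms j in tp≡0 i (j≢i ∘ sym)) ⟩
                     ⟨ t i , W (p i) ⟩
                       ≡⟨ (let (_ , _ , _ , _ , _ , tp≡bp) = terms i in tp≡bp) ⟩
                     ⟨ b , W (p i) ⟩                 ∎) ⟩
              (⟨ b , W (p i) ⟩ + - ⟨ a , W (p i) ⟩) + - ⟨ b , W (p i) ⟩
                ≡⟨ cong (λ z → (⟨ b , W (p i) ⟩ + - z) + - ⟨ b , W (p i) ⟩) (ap≡0 i) ⟩
              (⟨ b , W (p i) ⟩ + - 0#) + - ⟨ b , W (p i) ⟩
                ≡⟨ solve 1 (λ x → (x :+ :- con ℤ.+0) :+ :- x := con ℤ.+0) refl _ ⟩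
              0# ∎
        D≡0′ ← vanish D (D≡0 β (trans bβ≡1 (sym aβ≡1)) (λ i → let (_ , _ , tβ≡0 , _) = terms i in tβ≡0))
          (D≡0 (W v) (trans bv≡0 (sym av≡0)) (λ i → let (_ , _ , _ , tv≡0 , _) = terms i in tv≡0)) D≡0-p
        return (pos-resp (λ k → sym (x-y≡0⇒x≡y (D≡0′ k))) (sum-pos t λ i → proj₁ (proj₂ (terms i))))

-- Faces of the cube

free≟ : (c : CubeCoord) → Dec (c ≡ free)
free≟ lo   = no λ ()
free≟ hi   = no λ ()
free≟ free = yes refl

≤c-refl : ∀ c → c ≤c c
≤c-refl lo   = _
≤c-refl hi   = _
≤c-refl free = _

≤c-reflexive : ∀ {c e} → c ≡ e → c ≤c e
≤c-reflexive {c} refl = ≤c-refl c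

≤c-free : ∀ c → c ≤c free
≤c-free lo   = _
≤c-free hi   = _
≤c-free free = _

≤c-antisym : ∀ {c e} → c ≤c e → e ≤c c → c ≡ e
≤c-antisym {lo}   {lo}   _ _ = refl
≤c-antisym {hi}   {hi}   _ _ = refl
≤c-antisym {free} {free} _ _ = refl

≤c-fixed : ∀ {c e} → c ≤c e → e ≢ free → c ≡ e
≤c-fixed {lo}   {lo}   _ _  = refl
≤c-fixed {hi}   {hi}   _ _  = refl
≤c-fixed {c}    {free} _ nf = contradiction refl nf

free# : CubeCoord → ℕ
free# lo   = 0
free# hi   = 0
free# free = 1

cubeDim : ∀ {m} → CubeFace m → ℕ
cubeDim {zero}  σ = 0
cubeDim {suc m} σ = free# (σ zero) ℕ.+ cubeDim (σ ∘ suc)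

cubeDim≤ : ∀ {m} (σ : CubeFace m) → cubeDim σ ℕ.≤ m
cubeDim≤ {zero}  σ = z≤n
cubeDim≤ {suc m} σ with σ zero
... | lo   = ℕ.m≤n⇒m≤1+n (cubeDim≤ (σ ∘ suc))
... | hi   = ℕ.m≤n⇒m≤1+n (cubeDim≤ (σ ∘ suc))
... | free = s≤s (cubeDim≤ (σ ∘ suc))

corner : ∀ {m} (σ : CubeFace m) → cubeDim σ ≡ 0 → ∀ k → σ k ≢ free
corner {suc m} σ dim≡0 zero    σ≡free with σ zero
corner {suc m} σ ()    zero    σ≡free | free
corner {suc m} σ dim≡0 (suc k) = corner (σ ∘ suc) (ℕ.m+n≡0⇒n≡0 (free# (σ zero)) dim≡0) k

edge : ∀ {m} → CubeFace m → Fin m → CubeFace m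
edge ρ i = updateAt ρ i (const free)

ridge : ∀ {m} → CubeFace m → Fin m → CubeFace m
ridge ρ i = updateAt (const free) i (const (ρ i))

edge-at : ∀ {m} (ρ : CubeFace m) i → edge ρ i i ≡ free
edge-at ρ i = updateAt-updates i ρ

edge-off : ∀ {m} (ρ : CubeFace m) i k → k ≢ i → edge ρ i k ≡ ρ k
edge-off ρ i k = updateAt-minimal k i ρ

ridge-at : ∀ {m} (ρ : CubeFace m) i → ridge ρ i i ≡ ρ i
ridge-at ρ i = updateAt-updates i (const free)

ridge-off : ∀ {m} (ρ : CubeFace m) i k → k ≢ i → ridge ρ i k ≡ free
ridge-off ρ i k = updateAt-minimal k i (const free)

ρ⊑edge : ∀ {m} (ρ : CubeFace m) i → ρ ⊑c edge ρ i
ρ⊑edge ρ i k with k Fin.≟ i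
... | yes refl = subst (ρ i ≤c_) (sym (edge-at ρ i)) (≤c-free (ρ i))
... | no k≢i   = ≤c-reflexive (sym (edge-off ρ i k k≢i))

⊑ridge : ∀ {m} {ρ σ : CubeFace m} i → σ i ≡ ρ i → σ ⊑c ridge ρ i
⊑ridge {ρ = ρ} {σ} i σi≡ρi k with k Fin.≟ i
... | yes refl = ≤c-reflexive (trans σi≡ρi (sym (ridge-at ρ i)))
... | no k≢i   = subst (σ k ≤c_) (sym (ridge-off ρ i k k≢i)) (≤c-free (σ k))

edge⊑ : ∀ {m} {ρ σ : CubeFace m} → ρ ⊑c σ → ∀ i → σ i ≡ free → edge ρ i ⊑c σ
edge⊑ {ρ = ρ} {σ} ρ⊑σ i σi≡free k with k Fin.≟ i
... | yes refl = subst (edge ρ i i ≤c_) (sym σi≡free) (≤c-free (edge ρ i i))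
... | no k≢i   = subst (_≤c σ k) (sym (edge-off ρ i k k≢i)) (ρ⊑σ k)

edge∩ridge : ∀ {m} {ρ τ : CubeFace m} i → τ ⊑c edge ρ i → τ ⊑c ridge ρ i → τ ⊑c ρ
edge∩ridge {ρ = ρ} {τ} i τ⊑e τ⊑r k with k Fin.≟ i
... | yes refl = subst (τ i ≤c_) (ridge-at ρ i) (τ⊑r i)
... | no k≢i   = subst (τ k ≤c_) (edge-off ρ i k k≢i) (τ⊑e k)

edge⋢ρ : ∀ {m} (ρ : CubeFace m) i → ρ i ≢ free → ¬ edge ρ i ⊑c ρ
edge⋢ρ ρ i ρi≢free e⊑ρ with ρ i | subst (_≤c ρ i) (edge-at ρ i) (e⊑ρ i)
... | free | _ = ρi≢free refl

cubeDim-free : ∀ m → cubeDim {m} (const free) ≡ m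
cubeDim-free zero    = refl
cubeDim-free (suc m) = cong suc (cubeDim-free m)

cubeDim-ridge : ∀ {m} (ρ : CubeFace m) i → ρ i ≢ free → suc (cubeDim (ridge ρ i)) ≡ m
cubeDim-ridge {suc m} ρ zero ρ≢free with ρ zero
... | lo   = cong suc (cubeDim-free m)
... | hi   = cong suc (cubeDim-free m)
... | free = contradiction refl ρ≢free
cubeDim-ridge {suc m} ρ (suc i) ρ≢free = cong suc (cubeDim-ridge (ρ ∘ suc) i ρ≢free)

cubeDim-edge : ∀ {m} (ρ : CubeFace m) i → cubeDim ρ ≡ 0 → cubeDim (edge ρ i) ≡ 1
cubeDim-edge {suc m} ρ zero    e = cong suc (ℕ.m+n≡0⇒n≡0 (free# (ρ zero)) e)
cubeDim-edge {suc m} ρ (suc i) e = trans (cong (ℕ._+ cubeDim (edge (ρ ∘ suc) i)) (ℕ.m+n≡0⇒m≡0 (free# (ρ zero)) e))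
  (cubeDim-edge (ρ ∘ suc) i (ℕ.m+n≡0⇒n≡0 (free# (ρ zero)) e))

module _ where
  open import Data.Vec.Functional using (_∷_)

  -- With `raise` it gives chains of cube faces through `σ` whose dimension changes by one at each
  -- step; they serve to find affine dimensions.
  lower : ∀ {m t} (σ : CubeFace m) → cubeDim σ ≡ suc t → ∃ λ τ → cubeDim τ ≡ t × τ ⊑c σ × ¬ σ ⊑c τ
  lower {suc m} σ e with σ zero in eq
  ... | free = lo ∷ (σ ∘ suc) , ℕ.suc-injective e
    , (λ { zero → subst (lo ≤c_) (sym eq) _ ; (suc k) → ≤c-refl _ })
    , λ σ⊑ → subst (_≤c lo) eq (σ⊑ zero)
  ... | lo with lower (σ ∘ suc) e
  ...   | τ , d , τ⊑σ , σ⋢τ = lo ∷ τ , d , (λ { zero → subst (lo ≤c_) (sym eq) _ ; (suc k) → τ⊑σ k })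
    , λ σ⊑ → σ⋢τ (σ⊑ ∘ suc)
  lower {suc m} σ e | hi with lower (σ ∘ suc) e
  ...   | τ , d , τ⊑σ , σ⋢τ = hi ∷ τ , d , (λ { zero → subst (hi ≤c_) (sym eq) _ ; (suc k) → τ⊑σ k })
    , λ σ⊑ → σ⋢τ (σ⊑ ∘ suc)

  raise : ∀ {m r} (σ : CubeFace m) → cubeDim σ ℕ.+ suc r ≡ m →
    ∃ λ τ → cubeDim τ ≡ suc (cubeDim σ) × σ ⊑c τ × ¬ τ ⊑c σ
  raise {zero}  σ ()
  raise {suc m} σ e with σ zero in eq
  ... | lo = free ∷ (σ ∘ suc) , refl , (λ { zero → ≤c-free (σ zero) ; (suc k) → ≤c-refl _ })
    , λ ⊑σ → subst (free ≤c_) eq (⊑σ zero)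
  ... | hi = free ∷ (σ ∘ suc) , refl , (λ { zero → ≤c-free (σ zero) ; (suc k) → ≤c-refl _ })
    , λ ⊑σ → subst (free ≤c_) eq (⊑σ zero)
  ... | free with raise (σ ∘ suc) (ℕ.suc-injective e)
  ...   | τ , d , σ⊑τ , τ⋢σ = free ∷ τ , cong suc d , (λ { zero → ≤c-free (σ zero) ; (suc k) → σ⊑τ k })
    , λ τ⊑ → τ⋢σ (τ⊑ ∘ suc)

-- Here m is the dimension of the facets, one less than that of the polytope.
record CubicalSphere (m n : ℕ) (f : ℕ → ℕ) : Set₁ where
  field
    face           : ∀ {i} → i ℕ.≤ m → Fin (f i) → Subset n
    face-injective : ∀ {i} (i≤m : i ℕ.≤ m) {x y} → face i≤m x ≡ face i≤m y → x ≡ y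

  facet : Fin (f m) → Subset n
  facet = face ℕ.≤-refl

  field
    cover     : ∀ {i} (i≤m : i ℕ.≤ m) x → ∃ λ F → face i≤m x ⊆ facet F
    φ         : Fin (f m) → CubeFace m → Subset n
    φ-facet   : ∀ F σ → φ F σ ⊆ facet F
    φ-mono    : ∀ F {τ σ} → τ ⊑c σ → φ F τ ⊆ φ F σ
    φ-reflect : ∀ F {τ σ} → φ F τ ⊆ φ F σ → τ ⊑c σ
    φ-face    : ∀ {i} (i≤m : i ℕ.≤ m) F σ → cubeDim σ ≡ i → ∃ λ x → face i≤m x ≡ φ F σ
    φ-onto    : ∀ {i} (i≤m : i ℕ.≤ m) F x → face i≤m x ⊆ facet F →
                ∃ λ σ → φ F σ ≡ face i≤m x × cubeDim σ ≡ i
    _≼_       : Fin (f m) → Fin (f m) → Set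
    ≼-isDecTotalOrder : IsDecTotalOrder _≡_ _≼_

  Adjacent : Fin (f m) → CubeFace m → Fin m → Fin (f m) → Set
  Adjacent F ρ i F′ = F′ ≢ F × φ F (ridge ρ i) ⊆ facet F′

  -- The relation is a parameter because both the order and its reverse are to satisfy this.
  LocalOptimality : (Fin (f m) → Fin (f m) → Set) → Set
  LocalOptimality _⊴_ = ∀ F {ρ σ} → cubeDim ρ ≡ 0 → ρ ⊑c σ →
    (∀ i → σ i ≢ free → ∃ λ F′ → Adjacent F ρ i F′ × F ⊴ F′) →
    ∀ F″ → φ F σ ⊆ facet F″ → F ⊴ F″

  field
    adjacent  : ∀ F {ρ} → cubeDim ρ ≡ 0 → ∀ i → ∃ (Adjacent F ρ i)
    local-min : LocalOptimality _≼_
    local-max : LocalOptimality (flip _≼_)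
    -- This yields an edge at a vertex that leaves a given facet, hence one more edge than the facet
    -- itself has there.
    edge-out  : ∀ F F′ {ρ} → F ≢ F′ → cubeDim ρ ≡ 0 → φ F ρ ⊆ facet F′ →
                ∃ λ i → ¬ φ F (edge ρ i) ⊆ facet F′

-- The combinatorial sphere of a cubical polytope

open import Data.List.Relation.Unary.AllPairs using ([]; _∷_)

⊈⇒∃ : ∀ {n} {S T : Subset n} → ¬ S ⊆ T → ∃ λ j → j ∈ S × j ∉ T
⊈⇒∃ {n} {S} {T} S⊈T with Fin.any? (λ j → (j ∈? S) ×-dec ¬? (j ∈? T))
... | yes found = found
... | no none   = contradiction
  (λ {j} j∈S → decidable-stable (j ∈? T) λ j∉T → none (j , j∈S , j∉T)) S⊈T

lookup-injective : ∀ {A : Set} {xs : List A} → Unique xs → ∀ i j → lookup xs i ≡ lookup xs j → i ≡ j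
lookup-injective (x∉ ∷ u) zero    zero    e = refl
lookup-injective (x∉ ∷ u) zero    (suc j) e = contradiction e (All.lookup x∉ (∈-lookup j))
lookup-injective (x∉ ∷ u) (suc i) zero    e = contradiction (sym e) (All.lookup x∉ (∈-lookup i))
lookup-injective (x∉ ∷ u) (suc i) (suc j) e = cong suc (lookup-injective u i j e)

module Build (K : OrderedField) {m n : ℕ} (V : Fin n → Point K (suc m))
  (dim-V : HasAffineDim K V ⊤ (suc m)) (cubical : IsCubical K V)
  (f : ℕ → ℕ) (counts : ∀ i → i ℕ.< suc m → FaceCount K V i (f i)) where
  open Linear K
  open Lexicographic K
  open Geometry K V
  open Full dim-V
  open LocalCone K V dim-V
  open ≡-Reasoning

  abstract
    face : ∀ {i} → i ℕ.≤ m → Fin (f i) → Subset n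
    face {i} i≤m x with counts i (s≤s i≤m)
    ... | L , len , _ = lookup L (cast (sym len) x)

    face-injective : ∀ {i} (i≤m : i ℕ.≤ m) {x y} → face i≤m x ≡ face i≤m y → x ≡ y
    face-injective {i} i≤m {x} {y} e with counts i (s≤s i≤m)
    ... | L , len , uniq , _ = Fin.toℕ-injective (begin
      toℕ x                    ≡⟨ Fin.toℕ-cast (sym len) x ⟨
      toℕ (cast (sym len) x)   ≡⟨ cong toℕ (lookup-injective uniq _ _ e) ⟩
      toℕ (cast (sym len) y)   ≡⟨ Fin.toℕ-cast (sym len) y ⟩
      toℕ y                    ∎)

    face-dim : ∀ {i} (i≤m : i ℕ.≤ m) x → IsFaceOfDim K V i (face i≤m x)
    face-dim {i} i≤m x with counts i (s≤s i≤m)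
    ... | L , len , _ , sound , _ = sound _ (∈-lookup {xs = L} (cast (sym len) x))

    face-complete : ∀ {i} (i≤m : i ℕ.≤ m) {S} → IsFaceOfDim K V i S → ∃ λ x → face i≤m x ≡ S
    face-complete {i} i≤m {S} S-dim with counts i (s≤s i≤m)
    ... | L , len , _ , _ , complete = cast len (index S∈L) , (begin
      lookup L (cast (sym len) (cast len (index S∈L)))  ≡⟨ cong (lookup L) (Fin.cast-involutive (sym len) len _) ⟩
      lookup L (index S∈L)                              ≡⟨ lookup-index S∈L ⟨
      S                                                 ∎)
      where
      S∈L : S ∈ₗ L
      S∈L = complete S S-dim

  facet : Fin (f m) → Subset n
  facet = face ℕ.≤-refl

  facet-face : ∀ F → ∃ λ a → Supports a (facet F)
  facet-face F = face⇒supports (proj₁ (face-dim ℕ.≤-refl F))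

  facet-hasDim : ∀ F → HasDim (facet F) m
  facet-hasDim F = dim⇒ (proj₂ (face-dim ℕ.≤-refl F))

  abstract
    normalized : ∀ F → ∃ λ a → Supports a (facet F) × Normal a
    normalized F = normalize (proj₂ (facet-face F)) (proj₂ (¬AI⇒proper (proj₂ (facet-hasDim F))))

    a : Fin (f m) → Vect (2 ℕ.+ m)
    a F = proj₁ (normalized F)

    a-supports : ∀ F → Supports (a F) (facet F)
    a-supports F = proj₁ (proj₂ (normalized F))

    a-normal : ∀ F → Normal (a F)
    a-normal F = proj₂ (proj₂ (normalized F))

  facet-unique : ∀ {F F′} → (∀ k → a F k ≡ a F′ k) → F ≡ F′
  facet-unique {F} {F′} aF≡aF′ = face-injective ℕ.≤-refl (⊆-antisym
    (λ {j} j∈F → off (a-supports F′) (trans (sym (pair-≡ j)) (on (a-supports F) j∈F)))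
    (λ {j} j∈F′ → off (a-supports F) (trans (pair-≡ j) (on (a-supports F′) j∈F′))))
    where
    pair-≡ : ∀ j → ⟨ a F , W j ⟩ ≡ ⟨ a F′ , W j ⟩
    pair-≡ j = sum-cong-≗ λ k → cong (_* W j k) (aF≡aF′ k)

  cube : ∀ F → CombCube K V (facet F) m
  cube F = cubical (facet F) (face-dim ℕ.≤-refl F)

  φ : Fin (f m) → CubeFace m → Subset n
  φ F = proj₁ (cube F)

  φ-isFace : ∀ F σ → IsFace K V (φ F σ)
  φ-isFace F σ = proj₁ (proj₁ (proj₂ (cube F)) σ)

  φ-facet : ∀ F σ → φ F σ ⊆ facet F
  φ-facet F σ = proj₂ (proj₁ (proj₂ (cube F)) σ)

  φ-all : ∀ F {T} → IsFace K V T → T ⊆ facet F → ∃ λ σ → φ F σ ≡ T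
  φ-all F {T} = proj₁ (proj₂ (proj₂ (cube F))) T

  φ-reflect : ∀ F {τ σ} → φ F τ ⊆ φ F σ → τ ⊑c σ
  φ-reflect F {τ} {σ} = proj₁ (proj₂ (proj₂ (proj₂ (cube F)))) σ τ

  φ-mono : ∀ F {τ σ} → τ ⊑c σ → φ F τ ⊆ φ F σ
  φ-mono F {τ} {σ} = proj₂ (proj₂ (proj₂ (proj₂ (cube F)))) σ τ

  AI-strict : ∀ F {τ σ t} → τ ⊑c σ → ¬ σ ⊑c τ → AI (φ F τ) t → AI (φ F σ) (suc t)
  AI-strict F {τ} τ⊑σ σ⋢τ =
    let (j , j∈σ , j∉τ) = ⊈⇒∃ (σ⋢τ ∘ φ-reflect F)
        (γ , sγ) = face⇒supports (φ-isFace F τ)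
    in AI-extend γ (on sγ) (φ-mono F τ⊑σ) j∈σ (j∉τ ∘ off sγ)

  φ-AI-lower : ∀ F t σ → cubeDim σ ≡ t → AI (φ F σ) (suc t)
  φ-AI-lower F zero σ _ with proj₁ (φ-isFace F σ)
  ... | j , j∈σ = const j , const j∈σ , λ c rel → λ { zero → begin
    c zero            ≡⟨ solve 1 (λ x → x := x :+ con ℤ.+0) refl (c zero) ⟩
    c zero + 0#       ≡⟨ cong (_+ 0#) (*-identityʳ (c zero)) ⟨
    c zero * 1# + 0#  ≡⟨ rel zero ⟩
    0#                ∎ }
  φ-AI-lower F (suc t) σ e with lower σ e
  ... | τ , dim≡t , τ⊑σ , σ⋢τ = AI-strict F τ⊑σ σ⋢τ (φ-AI-lower F t τ dim≡t)

  φ-AI-upper : ∀ F r {σ t} → cubeDim σ ℕ.+ r ≡ m → AI (φ F σ) t → AI (facet F) (r ℕ.+ t)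
  φ-AI-upper F zero    _ ai = AI-⊆ (φ-facet F _) ai
  φ-AI-upper F (suc r) {σ} {t} e ai with raise σ e
  ... | τ , dim≡ , σ⊑τ , τ⋢σ = subst (AI (facet F)) (ℕ.+-suc r t)
    (φ-AI-upper F r (trans (cong (ℕ._+ r) dim≡) (trans (sym (ℕ.+-suc _ r)) e)) (AI-strict F σ⊑τ τ⋢σ ai))

  -- An isomorphism of face posets does not mention affine dimension. A chain of faces from a corner
  -- up to `σ` bounds it below, and a chain from `σ` to the whole cube bounds it above: each step
  -- gains a point off a supporting hyperplane, and the facet has dimension `m`.
  φ-dim : ∀ F σ → HasDim (φ F σ) (cubeDim σ)
  φ-dim F σ = φ-AI-lower F _ σ refl , λ ai → proj₂ (facet-hasDim F)
    (subst (AI (facet F)) (begin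
      m ℕ.∸ cubeDim σ ℕ.+ (2 ℕ.+ cubeDim σ)    ≡⟨ ℕ.+-comm (m ℕ.∸ cubeDim σ) _ ⟩
      2 ℕ.+ (cubeDim σ ℕ.+ (m ℕ.∸ cubeDim σ))  ≡⟨ cong (2 ℕ.+_) (ℕ.m+[n∸m]≡n (cubeDim≤ σ)) ⟩
      2 ℕ.+ m ∎)
    (φ-AI-upper F (m ℕ.∸ cubeDim σ) (ℕ.m+[n∸m]≡n (cubeDim≤ σ)) ai))

  φ-face : ∀ {i} (i≤m : i ℕ.≤ m) F σ → cubeDim σ ≡ i → ∃ λ x → face i≤m x ≡ φ F σ
  φ-face i≤m F σ refl = face-complete i≤m (φ-isFace F σ , dim⇐ (φ-dim F σ))

  φ-onto : ∀ {i} (i≤m : i ℕ.≤ m) F x → face i≤m x ⊆ facet F →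
    ∃ λ σ → φ F σ ≡ face i≤m x × cubeDim σ ≡ i
  φ-onto i≤m F x x⊆F = let (σ , φσ≡x) = φ-all F (proj₁ (face-dim i≤m x)) x⊆F in σ , φσ≡x
    , dim-unique (subst (λ S → HasDim S (cubeDim σ)) φσ≡x (φ-dim F σ)) (dim⇒ (proj₂ (face-dim i≤m x)))

  facet-index : ∀ {S} → Facet S → ∃ λ F → facet F ≡ S
  facet-index {S} fS = face-complete ℕ.≤-refl
    (supports⇒face (proj₁ (rank fS) zero , proj₁ (proj₂ (rank fS)) zero) (supports fS) , dim⇐ (rank fS , ¬full fS))

  cover : ∀ {i} (i≤m : i ℕ.≤ m) x → ∃ λ F → face i≤m x ⊆ facet F
  cover {i} i≤m x = decidable-stable (Fin.any? λ F → face i≤m x ⊆? facet F) (do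
    (S , fS , x⊆S) ← facet-above (proj₂ (face⇒supports (proj₁ (face-dim i≤m x))))
      (proj₂ (dim⇒ (proj₂ (face-dim i≤m x))) ∘ AI-≤ (ℕ.≤⇒≤′ (s≤s (s≤s i≤m))))
    let (F , F≡S) = facet-index fS
    return {A = ∃ λ F → face i≤m x ⊆ facet F} (F , subst (face i≤m x ⊆_) (sym F≡S) x⊆S))

  -- The neighbours of the vertex ρ in a facet, with functionals supporting the ridges at ρ.
  module Star (F : Fin (f m)) (ρ : CubeFace m) (ρ-corner : cubeDim ρ ≡ 0) where

    abstract
      v : Fin n
      v = proj₁ (proj₁ (φ-isFace F ρ))

      v∈ρ : v ∈ φ F ρ
      v∈ρ = proj₂ (proj₁ (φ-isFace F ρ))

      -- The list of points may contain repetitions and points that are not vertices. Any listed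
      -- point of the edge away from the corner will do, since only its direction matters.
      neighbour : ∀ i → ∃ λ j → j ∈ φ F (edge ρ i) × j ∉ φ F ρ
      neighbour i = ⊈⇒∃ (edge⋢ρ ρ i (corner ρ ρ-corner i) ∘ φ-reflect F)

      p : Fin m → Fin n
      p i = proj₁ (neighbour i)

      p∈edge : ∀ i → p i ∈ φ F (edge ρ i)
      p∈edge i = proj₁ (proj₂ (neighbour i))

      p∉ρ : ∀ i → p i ∉ φ F ρ
      p∉ρ i = proj₂ (proj₂ (neighbour i))

      γ : Fin m → Vect (2 ℕ.+ m)
      γ i = proj₁ (face⇒supports (φ-isFace F (ridge ρ i)))

      γ-supports : ∀ i → Supports (γ i) (φ F (ridge ρ i))
      γ-supports i = proj₂ (face⇒supports (φ-isFace F (ridge ρ i)))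

    ρ⊑ridge : ∀ i → ρ ⊑c ridge ρ i
    ρ⊑ridge i = ⊑ridge {ρ = ρ} {ρ} i refl

    v∈ridge : ∀ i → v ∈ φ F (ridge ρ i)
    v∈ridge i = φ-mono F (ρ⊑ridge i) v∈ρ

    p∈ridge : ∀ i j → j ≢ i → p j ∈ φ F (ridge ρ i)
    p∈ridge i j j≢i = φ-mono F (edge⊑ (ρ⊑ridge i) j (ridge-off ρ i j j≢i)) (p∈edge j)

    -- The intersection of edge and ridge in direction `i` is again a face, hence comes from a cube
    -- face `τ`. This lies below both and therefore below `ρ`, whereas `p i` was chosen off `ρ`.
    p∉ridge : ∀ i → p i ∉ φ F (ridge ρ i)
    p∉ridge i pᵢ∈ridge = p∉ρ i (φ-mono F τ⊑ρ (subst (p i ∈_) (sym τ≡∩) p∈∩))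
      where
      p∈∩ : p i ∈ φ F (edge ρ i) ∩ φ F (ridge ρ i)
      p∈∩ = x∈p∩q⁺ (p∈edge i , pᵢ∈ridge)
      intersection : ∃ λ τ → φ F τ ≡ φ F (edge ρ i) ∩ φ F (ridge ρ i)
      intersection = φ-all F
        (supports⇒face (p i , p∈∩) (∩-supports (proj₂ (face⇒supports (φ-isFace F (edge ρ i)))) (γ-supports i)))
        (λ j∈∩ → φ-facet F (edge ρ i) (p∩q⊆p (φ F (edge ρ i)) (φ F (ridge ρ i)) j∈∩))
      τ : CubeFace m
      τ = proj₁ intersection
      τ≡∩ : φ F τ ≡ φ F (edge ρ i) ∩ φ F (ridge ρ i)
      τ≡∩ = proj₂ intersection
      τ⊑ρ : τ ⊑c ρ
      τ⊑ρ = edge∩ridge i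
        (φ-reflect F (subst (_⊆ φ F (edge ρ i)) (sym τ≡∩) (p∩q⊆p (φ F (edge ρ i)) (φ F (ridge ρ i)))))
        (φ-reflect F (subst (_⊆ φ F (ridge ρ i)) (sym τ≡∩) (p∩q⊆q (φ F (edge ρ i)) (φ F (ridge ρ i)))))

    v∈F : v ∈ facet F
    v∈F = φ-facet F ρ v∈ρ

    p∈F : ∀ i → p i ∈ facet F
    p∈F i = φ-facet F (edge ρ i) (p∈edge i)

    -- The two scaled normals agree on the basis formed by `β`, `v` and the `p i`.
    same-facet : ∀ F′ → v ∈ facet F′ → (∀ i → p i ∈ facet F′) → F′ ≡ F
    same-facet F′ v∈F′ p∈F′ = decidable-stable (F′ Fin.≟ F) (do
      a≡ ← normal-unique (a-normal F) v p γ
        (on (a-supports F) v∈F) (λ i → on (a-supports F) (p∈F i))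
        (λ i → on (γ-supports i) (v∈ridge i)) (λ i j j≢i → on (γ-supports i) (p∈ridge i j j≢i))
        (λ i → p∉ridge i ∘ off (γ-supports i))
        (a-normal F′) (on (a-supports F′) v∈F′) (λ i → on (a-supports F′) (p∈F′ i))
      return (facet-unique a≡))

    edge-out : ∀ F′ → F ≢ F′ → φ F ρ ⊆ facet F′ → ∃ λ i → ¬ φ F (edge ρ i) ⊆ facet F′
    edge-out F′ F≢F′ ρ⊆F′ with Fin.any? (λ i → ¬? (φ F (edge ρ i) ⊆? facet F′))
    ... | yes found = found
    ... | no none   = contradiction (sym (same-facet F′ (ρ⊆F′ v∈ρ) λ i →
      decidable-stable (p i ∈? facet F′) λ p∉F′ → none (i , λ e⊆F′ → p∉F′ (e⊆F′ (p∈edge i))))) F≢F′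

    Adjacent : Fin m → Fin (f m) → Set
    Adjacent i F′ = F′ ≢ F × φ F (ridge ρ i) ⊆ facet F′

    adjacent : ∀ i → ∃ (Adjacent i)
    adjacent i = decidable-stable
      (Fin.any? λ F′ → ¬? (F′ Fin.≟ F) ×-dec (φ F (ridge ρ i) ⊆? facet F′)) (do
        (S , fS , r⊆S , S≢F) ← other-facet refl facetF (γ-supports i) (φ-facet F (ridge ρ i))
          (subst (AI (φ F (ridge ρ i))) (cubeDim-ridge ρ i (corner ρ ρ-corner i))
            (φ-AI-lower F _ (ridge ρ i) refl))
          (p i , p∈F i , p∉ridge i)
        let (F′ , F′≡S) = facet-index fS
        return {A = ∃ (Adjacent i)}
          (F′ , (λ F′≡F → S≢F (trans (sym F′≡S) (cong facet F′≡F))) , subst (_ ⊆_) (sym F′≡S) r⊆S))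
      where
      facetF : Facet (facet F)
      facetF = record { supports = a-supports F ; rank = proj₁ (facet-hasDim F) ; ¬full = proj₂ (facet-hasDim F) }

    local-optimality : (C : Cone (2 ℕ.+ m)) → ∀ {σ} → ρ ⊑c σ →
      (∀ i → σ i ≢ free → ∃ λ F′ → Adjacent i F′ × Cone.Pos C (diff (a F′) (a F))) →
      ∀ F″ → φ F σ ⊆ facet F″ → ¬ ¬ Cone.Pos C (diff (a F″) (a F))
    local-optimality C {σ} ρ⊑σ better F″ σ⊆F″ =
      local⇒global (a-normal F) v p γ
        (on (a-supports F) v∈F) (λ i → on (a-supports F) (p∈F i))
        (λ i → on (γ-supports i) (v∈ridge i)) (λ i j j≢i → on (γ-supports i) (p∈ridge i j j≢i))
        (λ i → p∉ridge i ∘ off (γ-supports i)) C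
        (a-normal F″) (nonneg (a-supports F″)) (on (a-supports F″) (σ⊆F″ (φ-mono F ρ⊑σ v∈ρ)))
        λ i → case free≟ (σ i) of λ where
          -- In a free direction the edge lies in the face and so in `F″`, which makes the
          -- coefficient of this term zero.
          (yes σᵢ≡free) → inj₁ (on (a-supports F″) (σ⊆F″ (φ-mono F (edge⊑ ρ⊑σ i σᵢ≡free) (p∈edge i))))
          (no σᵢ≢free)  → case better i σᵢ≢free of λ { (F′ , (F′≢F , ridge⊆F′) , pos) →
            inj₂ (a F′ , a-normal F′ , nonneg (a-supports F′) , on (a-supports F′) (ridge⊆F′ (v∈ridge i))
              , (λ j j≢i → on (a-supports F′) (ridge⊆F′ (p∈ridge i j j≢i)))
              -- If the normal of `F′` vanished at `p i` too, `F′` would contain the whole star and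
              -- be `F`.
              , (λ a′p≡0 → F′≢F (same-facet F′ (ridge⊆F′ (v∈ridge i)) λ j → case j Fin.≟ i of λ where
                  (yes refl) → off (a-supports F′) a′p≡0
                  (no j≢i)   → ridge⊆F′ (p∈ridge i j j≢i)))
              , pos) }

  _≼_ : Fin (f m) → Fin (f m) → Set
  F ≼ F′ = Lex (diff (a F′) (a F))

  private
    neg-diff : ∀ x y → x + - y ≡ - (y + - x)
    neg-diff = solve 2 (λ x y → x :+ :- y := :- (y :+ :- x)) refl

  ≼-refl : ∀ {F F′} → F ≡ F′ → F ≼ F′
  ≼-refl {F} refl = lex-resp (λ k → sym (-‿inverseʳ (a F k))) lex-zero

  ≼-trans : ∀ {F F′ F″} → F ≼ F′ → F′ ≼ F″ → F ≼ F″
  ≼-trans {F} {F′} {F″} l l′ = lex-resp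
    (λ k → solve 3 (λ x y z → (y :+ :- x) :+ (z :+ :- y) := z :+ :- x) refl (a F k) (a F′ k) (a F″ k))
    (lex-+ {x = diff (a F′) (a F)} {diff (a F″) (a F′)} l l′)

  ≼-antisym : ∀ {F F′} → F ≼ F′ → F′ ≼ F → F ≡ F′
  ≼-antisym {F} {F′} l l′ = facet-unique λ k → x-y≡0⇒x≡y
    (lex-antisym {x = diff (a F) (a F′)} l′ (lex-resp (λ k → neg-diff (a F′ k) (a F k)) l) k)

  ≼-total : ∀ F F′ → ¬ ¬ (F ≼ F′ ⊎ F′ ≼ F)
  ≼-total F F′ = do
    inj₁ l ← lex-total (diff (a F′) (a F))
      where inj₂ l → return (inj₂ (lex-resp (λ k → sym (neg-diff (a F k) (a F′ k))) l))
    return (inj₁ l)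

  sphere : ¬ ¬ CubicalSphere m n f
  sphere = do
    -- There are only finitely many pairs of facets, so deciding and comparing all of them fits
    -- under a single double negation.
    _≼?_ ← ¬¬-Π (f m) (λ F → ¬¬-dec (f m) (F ≼_))
    total ← ¬¬-Π (f m) (λ F → ¬¬-Π (f m) (≼-total F))
    return (record
      { face = face ; face-injective = face-injective ; cover = cover
      ; φ = φ ; φ-facet = φ-facet ; φ-mono = φ-mono ; φ-reflect = φ-reflect
      ; φ-face = φ-face ; φ-onto = φ-onto
      ; _≼_ = _≼_
      ; ≼-isDecTotalOrder = record
          { isTotalOrder = record
              { isPartialOrder = record
                  { isPreorder = record { isEquivalence = isEquivalence ; reflexive = ≼-refl ; trans = ≼-trans }
                  ; antisym = ≼-antisym }
              ; total = total }
          ; _≟_ = Fin._≟_ ; _≤?_ = _≼?_ }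
      ; adjacent = λ F {ρ} → Star.adjacent F ρ
      ; local-min = λ F {ρ} dim≡0 ρ⊑σ better F″ σ⊆F″ → decidable-stable (F ≼? F″)
          (Star.local-optimality F ρ dim≡0 (lexCone _) ρ⊑σ better F″ σ⊆F″)
      ; local-max = λ F {ρ} dim≡0 ρ⊑σ better F″ σ⊆F″ → decidable-stable (F″ ≼? F) (do
          l ← Star.local-optimality F ρ dim≡0 (opposite (lexCone _)) ρ⊑σ
            (λ i σᵢ≢free → let (F′ , adj , l) = better i σᵢ≢free in
              F′ , adj , lex-resp (λ k → neg-diff (a F k) (a F′ k)) l)
            F″ σ⊆F″
          return (lex-resp (λ k → sym (neg-diff (a F k) (a F″ k))) l))
      ; edge-out = λ F F′ {ρ} F≢F′ dim≡0 → Star.edge-out F ρ dim≡0 F′ F≢F′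
      })

-- Counting

open import Data.List using ([]; _∷_)
open import Data.List.Relation.Unary.All using (All; []; _∷_)
open import Data.Nat using (_+_; _*_; _∸_; _^_; _≤?_; _<?_)
open import Data.Nat.Combinatorics using (_C_; nCn≡1; nCk≡nC[n∸k]; nCk+nC[k+1]≡[n+1]C[k+1])
open import Data.Vec using ([]; _∷_)
open import Algebra.Properties.Semiring.Sum ℕ.+-*-semiring
  using (sum; sum-cong-≗; sum-remove; ∑-distrib-+; ∑-comm; *-distribˡ-sum; sum-replicate-zero)
open ≡-Reasoning

ind : ∀ {A : Set} → Dec A → ℕ
ind (yes _) = 1
ind (no _)  = 0

ind-yes : ∀ {A : Set} (A? : Dec A) → A → ind A? ≡ 1
ind-yes (yes _) _ = refl
ind-yes (no ¬a) a = contradiction a ¬a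

ind-no : ∀ {A : Set} (A? : Dec A) → ¬ A → ind A? ≡ 0
ind-no (yes a) ¬a = contradiction a ¬a
ind-no (no _)  _  = refl

ind-× : ∀ {A B : Set} (A? : Dec A) (B? : Dec B) → ind A? * ind B? ≡ ind (A? ×-dec B?)
ind-× (yes _) (yes _) = refl
ind-× (yes _) (no _)  = refl
ind-× (no _)  (yes _) = refl
ind-× (no _)  (no _)  = refl

sum-const : ∀ n c → sum {n} (const c) ≡ n * c
sum-const zero    c = refl
sum-const (suc n) c = cong (c +_) (sum-const n c)

sum-mono : ∀ {n} {g h : Fin n → ℕ} → (∀ i → g i ≤ h i) → sum g ≤ sum h
sum-mono {zero}  g≤h = z≤n
sum-mono {suc n} g≤h = ℕ.+-mono-≤ (g≤h zero) (sum-mono (g≤h ∘ suc))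

module _ {n : ℕ} {P : Fin n → Set} (P? : ∀ x → Dec (P x)) where

  count : ℕ
  count = sum λ x → ind (P? x)

  count-none : (∀ x → ¬ P x) → count ≡ 0
  count-none none = trans (sum-cong-≗ λ x → ind-no (P? x) (none x)) (sum-replicate-zero n)

count-unique : ∀ {n} {P : Fin n → Set} (P? : ∀ x → Dec (P x)) x → P x → (∀ y → P y → y ≡ x) → count P? ≡ 1
count-unique {suc n} P? x px unique = begin
  count P?                          ≡⟨ sum-remove {i = x} (λ y → ind (P? y)) ⟩
  ind (P? x) + count (P? ∘ punchIn x)
    ≡⟨ cong₂ _+_ (ind-yes (P? x) px) (count-none (P? ∘ punchIn x) λ y py → Fin.punchInᵢ≢i x y (unique _ py)) ⟩
  1 ∎

module _ {n m : ℕ} {P : Fin n → Set} (P? : ∀ x → Dec (P x)) (h : Fin m → Fin n)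
  (h-injective : ∀ {x y} → h x ≡ h y → x ≡ y) (Ph : ∀ y → P (h y)) where

  private
    fibres : sum (λ x → count λ y → h y Fin.≟ x) ≡ m
    fibres = begin
      sum (λ x → sum λ y → ind (h y Fin.≟ x))   ≡⟨ ∑-comm (λ x y → ind (h y Fin.≟ x)) ⟩
      sum (λ y → count λ x → h y Fin.≟ x)
        ≡⟨ sum-cong-≗ (λ y → count-unique (h y Fin.≟_) (h y) refl (λ _ → sym)) ⟩
      sum {m} (const 1)                          ≡⟨ sum-const m 1 ⟩
      m * 1                                      ≡⟨ ℕ.*-identityʳ m ⟩
      m                                          ∎

    fibre : ∀ {x} y → h y ≡ x → count (λ y → h y Fin.≟ x) ≡ 1
    fibre y hy≡x = count-unique _ y hy≡x λ z hz≡x → h-injective (trans hz≡x (sym hy≡x))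

  -- The fibres of `h` have `m` points in all, at most one over each `x`, and none over an `x`
  -- outside `P`.
  count-≥ : m ≤ count P?
  count-≥ = subst (_≤ count P?) fibres (sum-mono λ x → bound x (Fin.any? λ y → h y Fin.≟ x))
    where
    bound : ∀ x → Dec (∃ λ y → h y ≡ x) → count (λ y → h y Fin.≟ x) ≤ ind (P? x)
    bound x (no none)       = subst (_≤ ind (P? x)) (sym (count-none _ λ y e → none (y , e))) z≤n
    bound x (yes (y , refl)) = ℕ.≤-reflexive (trans (fibre y refl) (sym (ind-yes (P? (h y)) (Ph y))))

  count-image : (∀ x → P x → ∃ λ y → h y ≡ x) → count P? ≡ m
  count-image onto = trans (sum-cong-≗ λ x → sym (eq x (P? x))) fibres
    where
    eq : ∀ x (px? : Dec (P x)) → count (λ y → h y Fin.≟ x) ≡ ind px?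
    eq x (yes px) = fibre (proj₁ (onto x px)) (proj₂ (onto x px))
    eq x (no ¬px) = count-none _ λ y hy≡x → ¬px (subst P hy≡x (Ph y))

-- Cube faces as vectors: equality of vectors is entrywise, as duplicate-free lists require, whereas
-- that of functions is not.
Code : ℕ → Set
Code m = Vec CubeCoord m

options : CubeCoord → List CubeCoord
options lo   = lo ∷ []
options hi   = hi ∷ []
options free = lo ∷ hi ∷ []

corners : ∀ {m} → CubeFace m → List (Code m)
corners {zero}  σ = [] ∷ []
corners {suc m} σ = cartesianProductWith _∷_ (options (σ zero)) (corners (σ ∘ suc))

length-corners : ∀ {m} (σ : CubeFace m) → length (corners σ) ≡ 2 ^ cubeDim σ
length-corners {zero}  σ = refl
length-corners {suc m} σ = begin
  length (corners σ)                                         ≡⟨ length-product (options (σ zero)) ⟩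
  length (options (σ zero)) * length (corners (σ ∘ suc))     ≡⟨ cong₂ _*_ (choices (σ zero)) (length-corners (σ ∘ suc)) ⟩
  2 ^ free# (σ zero) * 2 ^ cubeDim (σ ∘ suc)                 ≡⟨ ℕ.^-distribˡ-+-* 2 (free# (σ zero)) _ ⟨
  2 ^ cubeDim σ                                              ∎
  where
  length-product : ∀ cs {τs : List (Code m)} → length (cartesianProductWith _∷_ cs τs) ≡ length cs * length τs
  length-product []       = refl
  length-product (c ∷ cs) {τs} = trans (List.length-++ (map (c ∷_) τs))
    (cong₂ _+_ (List.length-map (c ∷_) τs) (length-product cs))
  choices : ∀ c → length (options c) ≡ 2 ^ free# c
  choices lo   = refl
  choices hi   = refl
  choices free = refl

corners-unique : ∀ {m} (σ : CubeFace m) → Unique (corners σ)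
corners-unique {zero}  σ = [] ∷ []
corners-unique {suc m} σ = Unique.cartesianProductWith⁺ _∷_ ∷-injective (options-unique (σ zero)) (corners-unique (σ ∘ suc))
  where
  options-unique : ∀ c → Unique (options c)
  options-unique lo   = [] ∷ []
  options-unique hi   = [] ∷ []
  options-unique free = ((λ ()) ∷ []) ∷ [] ∷ []

corners-sound : ∀ {m} (σ : CubeFace m) {τ} → τ ∈ₗ corners σ →
  cubeDim (Vec.lookup τ) ≡ 0 × Vec.lookup τ ⊑c σ
corners-sound {zero}  σ _ = refl , λ ()
corners-sound {suc m} σ τ∈ with ∈-cartesianProductWith⁻ _∷_ (options (σ zero)) (corners (σ ∘ suc)) τ∈
... | c , τ , c∈ , τ∈′ , refl = cong₂ _+_ (proj₁ (option (σ zero) c∈)) (proj₁ (corners-sound (σ ∘ suc) τ∈′))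
  , λ { zero → proj₂ (option (σ zero) c∈) ; (suc k) → proj₂ (corners-sound (σ ∘ suc) τ∈′) k }
  where
  option : ∀ s {c} → c ∈ₗ options s → free# c ≡ 0 × c ≤c s
  option lo   (here refl)         = refl , _
  option hi   (here refl)         = refl , _
  option free (here refl)         = refl , _
  option free (there (here refl)) = refl , _

corners-complete : ∀ {m} (σ : CubeFace m) {τ} → cubeDim τ ≡ 0 → τ ⊑c σ → Vec.tabulate τ ∈ₗ corners σ
corners-complete {zero}  σ _ _ = here refl
corners-complete {suc m} σ {τ} dim≡0 τ⊑σ = ∈-cartesianProductWith⁺ _∷_
  (option (τ zero) (σ zero) (ℕ.m+n≡0⇒m≡0 _ dim≡0) (τ⊑σ zero))
  (corners-complete (σ ∘ suc) (ℕ.m+n≡0⇒n≡0 (free# (τ zero)) dim≡0) (τ⊑σ ∘ suc))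
  where
  option : ∀ c s → free# c ≡ 0 → c ≤c s → c ∈ₗ options s
  option lo lo   _ _ = here refl
  option hi hi   _ _ = here refl
  option lo free _ _ = here refl
  option hi free _ _ = there (here refl)

-- The faces above the corner ρ that are fixed in exactly k coordinates, all of them in U.
stars : ∀ {m} → CubeFace m → {U : Fin m → Set} → (∀ i → Dec (U i)) → ℕ → List (Code m)
stars {zero}  ρ U? zero    = [] ∷ []
stars {zero}  ρ U? (suc k) = []
stars {suc m} ρ U? zero    = map (free ∷_) (stars (ρ ∘ suc) (U? ∘ suc) zero)
stars {suc m} ρ U? (suc k) with U? zero
... | yes _ = map (ρ zero ∷_) (stars (ρ ∘ suc) (U? ∘ suc) k) ++ map (free ∷_) (stars (ρ ∘ suc) (U? ∘ suc) (suc k))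
... | no _  = map (free ∷_) (stars (ρ ∘ suc) (U? ∘ suc) (suc k))

length-stars : ∀ {m} ρ {U : Fin m → Set} (U? : ∀ i → Dec (U i)) k → length (stars ρ U? k) ≡ count U? C k
length-stars {zero}  ρ U? zero    = refl
length-stars {zero}  ρ U? (suc k) = refl
length-stars {suc m} ρ U? zero    = begin
  length (map (free ∷_) (stars (ρ ∘ suc) (U? ∘ suc) 0))  ≡⟨ List.length-map (free ∷_) (stars (ρ ∘ suc) (U? ∘ suc) 0) ⟩
  length (stars (ρ ∘ suc) (U? ∘ suc) 0)                   ≡⟨ length-stars (ρ ∘ suc) (U? ∘ suc) 0 ⟩
  count (U? ∘ suc) C 0                                    ≡⟨ C0 (count (U? ∘ suc)) (count U?) ⟩
  count U? C 0                                            ∎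
  where
  C0 : ∀ a b → a C 0 ≡ b C 0
  C0 a b = trans (trans (nCk≡nC[n∸k] {0} {a} z≤n) (nCn≡1 a)) (sym (trans (nCk≡nC[n∸k] {0} {b} z≤n) (nCn≡1 b)))
length-stars {suc m} ρ U? (suc k) with U? zero
... | yes _ = begin
  length (map (ρ zero ∷_) stars₁ ++ map (free ∷_) stars₂)            ≡⟨ List.length-++ (map (ρ zero ∷_) stars₁) ⟩
  length (map (ρ zero ∷_) stars₁) + length (map (free ∷_) stars₂)
    ≡⟨ cong₂ _+_
         (trans (List.length-map (ρ zero ∷_) stars₁) (length-stars (ρ ∘ suc) (U? ∘ suc) k))
         (trans (List.length-map (free ∷_) stars₂) (length-stars (ρ ∘ suc) (U? ∘ suc) (suc k))) ⟩
  count (U? ∘ suc) C k + count (U? ∘ suc) C suc k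
    ≡⟨ nCk+nC[k+1]≡[n+1]C[k+1] (count (U? ∘ suc)) k ⟩
  suc (count (U? ∘ suc)) C suc k ∎
  where
  stars₁ stars₂ : List (Code m)
  stars₁ = stars (ρ ∘ suc) (U? ∘ suc) k
  stars₂ = stars (ρ ∘ suc) (U? ∘ suc) (suc k)
... | no _ = trans (List.length-map (free ∷_) (stars (ρ ∘ suc) (U? ∘ suc) (suc k)))
  (length-stars (ρ ∘ suc) (U? ∘ suc) (suc k))

InStar : ∀ {m} → CubeFace m → (Fin m → Set) → ℕ → CubeFace m → Set
InStar {m} ρ U k τ = (∀ i → τ i ≡ free ⊎ (τ i ≡ ρ i × U i)) × cubeDim τ + k ≡ m

fixed-dim : ∀ {c} → c ≢ free → free# c ≡ 0
fixed-dim {lo}   _ = refl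
fixed-dim {hi}   _ = refl
fixed-dim {free} f = contradiction refl f

stars-unique : ∀ {m} ρ → (∀ i → ρ i ≢ free) → {U : Fin m → Set} (U? : ∀ i → Dec (U i)) → ∀ k → Unique (stars ρ U? k)
stars-unique {zero}  ρ _ U? zero    = [] ∷ []
stars-unique {zero}  ρ _ U? (suc k) = []
stars-unique {suc m} ρ fixed U? zero = Unique.map⁺ ∷-injectiveʳ (stars-unique (ρ ∘ suc) (fixed ∘ suc) (U? ∘ suc) zero)
stars-unique {suc m} ρ fixed U? (suc k) with U? zero
... | yes _ = Unique.++⁺
  (Unique.map⁺ ∷-injectiveʳ (stars-unique (ρ ∘ suc) (fixed ∘ suc) (U? ∘ suc) k))
  (Unique.map⁺ ∷-injectiveʳ (stars-unique (ρ ∘ suc) (fixed ∘ suc) (U? ∘ suc) (suc k)))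
  λ (p , q) → case ∈-map⁻ (ρ zero ∷_) p , ∈-map⁻ (free ∷_) q of λ
    { ((_ , _ , e) , (_ , _ , e′)) → fixed zero (∷-injectiveˡ (trans (sym e) e′)) }
... | no _ = Unique.map⁺ ∷-injectiveʳ (stars-unique (ρ ∘ suc) (fixed ∘ suc) (U? ∘ suc) (suc k))

stars-sound : ∀ {m} ρ → (∀ i → ρ i ≢ free) → {U : Fin m → Set} (U? : ∀ i → Dec (U i)) → ∀ k {τ} →
  τ ∈ₗ stars ρ U? k → InStar ρ U k (Vec.lookup τ)
stars-sound {zero}  ρ _ U? zero _ = (λ ()) , refl
stars-sound {suc m} ρ fixed {U} U? k τ∈ = split k τ∈
  where
  Rest : ℕ → List (Code m)
  Rest = stars (ρ ∘ suc) (U? ∘ suc)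
  on-free : ∀ k {τ} → τ ∈ₗ map (free ∷_) (Rest k) → InStar ρ U k (Vec.lookup τ)
  on-free k τ∈ with ∈-map⁻ (free ∷_) τ∈
  ... | τ , τ∈′ , refl with stars-sound (ρ ∘ suc) (fixed ∘ suc) (U? ∘ suc) k τ∈′
  ...   | within , dim = (λ { zero → inj₁ refl ; (suc i) → within i }) , cong suc dim
  on-fixed : ∀ k {τ} → U zero → τ ∈ₗ map (ρ zero ∷_) (Rest k) → InStar ρ U (suc k) (Vec.lookup τ)
  on-fixed k u τ∈ with ∈-map⁻ (ρ zero ∷_) τ∈
  ... | τ , τ∈′ , refl with stars-sound (ρ ∘ suc) (fixed ∘ suc) (U? ∘ suc) k τ∈′
  ...   | within , dim = (λ { zero → inj₂ (refl , u) ; (suc i) → within i })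
    , trans (cong (λ z → z + cubeDim (Vec.lookup τ) + suc k) (fixed-dim (fixed zero)))
        (trans (ℕ.+-suc _ k) (cong suc dim))
  split : ∀ k {τ} → τ ∈ₗ stars ρ U? k → InStar ρ U k (Vec.lookup τ)
  split zero    τ∈ = on-free zero τ∈
  split (suc k) τ∈ with U? zero
  ... | no _  = on-free (suc k) τ∈
  ... | yes u = [ on-fixed k u , on-free (suc k) ]′ (∈-++⁻ (map (ρ zero ∷_) (Rest k)) τ∈)

stars-complete : ∀ {m} ρ → (∀ i → ρ i ≢ free) → {U : Fin m → Set} (U? : ∀ i → Dec (U i)) → ∀ k {τ} →
  InStar ρ U k τ → Vec.tabulate τ ∈ₗ stars ρ U? k
stars-complete {zero}  ρ _ U? zero _ = here refl
stars-complete {suc m} ρ fixed {U} U? k {τ} (within , dim) = [ on-free k dim , on-fixed k dim ]′ (within zero)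
  where
  Rest : ℕ → List (Code m)
  Rest = stars (ρ ∘ suc) (U? ∘ suc)
  rest : ∀ k → cubeDim (τ ∘ suc) + k ≡ m → Vec.tabulate (τ ∘ suc) ∈ₗ Rest k
  rest k dim′ = stars-complete (ρ ∘ suc) (fixed ∘ suc) (U? ∘ suc) k (within ∘ suc , dim′)
  prepend : ∀ {c τs} → τ zero ≡ c → Vec.tabulate (τ ∘ suc) ∈ₗ τs → Vec.tabulate τ ∈ₗ map (c ∷_) τs
  prepend refl = ∈-map⁺ (τ zero ∷_)
  on-free : ∀ k → cubeDim τ + k ≡ suc m → τ zero ≡ free → Vec.tabulate τ ∈ₗ stars ρ U? k
  on-free k dim τ₀≡free = go k (prepend τ₀≡free (rest k
    (ℕ.suc-injective (trans (cong (λ c → free# c + cubeDim (τ ∘ suc) + k) (sym τ₀≡free)) dim))))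
    where
    go : ∀ k → Vec.tabulate τ ∈ₗ map (free ∷_) (Rest k) → Vec.tabulate τ ∈ₗ stars ρ U? k
    go zero    τ∈ = τ∈
    go (suc k) τ∈ with U? zero
    ... | no _  = τ∈
    ... | yes _ = ∈-++⁺ʳ (map (ρ zero ∷_) (Rest k)) τ∈
  on-fixed : ∀ k → cubeDim τ + k ≡ suc m → τ zero ≡ ρ zero × U zero → Vec.tabulate τ ∈ₗ stars ρ U? k
  on-fixed k dim (τ₀≡ρ₀ , u) =
    go k (trans (cong (λ z → z + cubeDim (τ ∘ suc) + k) (sym (trans (cong free# τ₀≡ρ₀) (fixed-dim (fixed zero))))) dim)
    where
    go : ∀ k → cubeDim (τ ∘ suc) + k ≡ suc m → Vec.tabulate τ ∈ₗ stars ρ U? k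
    -- With no fixed coordinate allowed, the last `m` coordinates would have to contribute dimension
    -- 1 + m.
    go zero dim′ = contradiction (cubeDim≤ (τ ∘ suc))
      (ℕ.<⇒≱ (ℕ.≤-reflexive (trans (sym dim′) (ℕ.+-identityʳ _))))
    go (suc k) dim′ with U? zero
    ... | no ¬u = contradiction u ¬u
    ... | yes _ = ∈-++⁺ˡ (prepend τ₀≡ρ₀ (rest k (ℕ.suc-injective (trans (sym (ℕ.+-suc _ k)) dim′))))

-- Double counting of flags

module Counting {m n : ℕ} {f : ℕ → ℕ} (S : CubicalSphere m n f) where
  open CubicalSphere S
  open IsDecTotalOrder ≼-isDecTotalOrder using (isTotalOrder; total; antisym) renaming (_≤?_ to _≼?_)

  vertex : Fin (f 0) → Subset n
  vertex = face z≤n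

  φ-cong : ∀ F {σ τ} → (∀ k → σ k ≡ τ k) → φ F σ ≡ φ F τ
  φ-cong F e = ⊆-antisym (φ-mono F (λ k → ≤c-reflexive (e k))) (φ-mono F (λ k → ≤c-reflexive (sym (e k))))

  φ-injective : ∀ F {σ τ} → φ F σ ≡ φ F τ → ∀ k → σ k ≡ τ k
  φ-injective F {σ} {τ} e k = ≤c-antisym (φ-reflect F {σ} {τ} (λ {j} → subst (j ∈_) e) k)
    (φ-reflect F {τ} {σ} (λ {j} → subst (j ∈_) (sym e)) k)

  -- Inside one facet `F`, polytope faces and cube faces correspond under `φ F`. Counting faces thus
  -- becomes measuring a duplicate-free list of codes.
  count-codes : ∀ {i} (i≤m : i ≤ m) F {P : Fin (f i) → Set} (P? : ∀ x → Dec (P x)) {codes : List (Code m)} →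
    Unique codes → (∀ {τ} → τ ∈ₗ codes → cubeDim (Vec.lookup τ) ≡ i) →
    (∀ {τ x} → τ ∈ₗ codes → face i≤m x ≡ φ F (Vec.lookup τ) → P x) →
    (∀ x → P x → ∃ λ σ → φ F σ ≡ face i≤m x × Vec.tabulate σ ∈ₗ codes) →
    count P? ≡ length codes
  count-codes {i} i≤m F {P} P? {codes} unique dims sound complete = count-image P? h h-injective
    (λ y → sound (∈-lookup y) (h-face y)) onto
    where
    h : Fin (length codes) → Fin (f i)
    h y = proj₁ (φ-face i≤m F (Vec.lookup (List.lookup codes y)) (dims (∈-lookup y)))
    h-face : ∀ y → face i≤m (h y) ≡ φ F (Vec.lookup (List.lookup codes y))
    h-face y = proj₂ (φ-face i≤m F (Vec.lookup (List.lookup codes y)) (dims (∈-lookup y)))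
    h-injective : ∀ {x y} → h x ≡ h y → x ≡ y
    h-injective {x} {y} e = lookup-injective unique x y (begin
      List.lookup codes x                                ≡⟨ tabulate∘lookup _ ⟨
      Vec.tabulate (Vec.lookup (List.lookup codes x))    ≡⟨ tabulate-cong (φ-injective F (begin
        φ F (Vec.lookup (List.lookup codes x))             ≡⟨ h-face x ⟨
        face i≤m (h x)                                     ≡⟨ cong (face i≤m) e ⟩
        face i≤m (h y)                                     ≡⟨ h-face y ⟩
        φ F (Vec.lookup (List.lookup codes y))             ∎)) ⟩
      Vec.tabulate (Vec.lookup (List.lookup codes y))    ≡⟨ tabulate∘lookup _ ⟩
      List.lookup codes y                                ∎)
    onto : ∀ x → P x → ∃ λ y → h y ≡ x
    onto x px = let (σ , φσ≡x , σ∈) = complete x px in index σ∈ , face-injective i≤m (begin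
      face i≤m (h (index σ∈))                            ≡⟨ h-face (index σ∈) ⟩
      φ F (Vec.lookup (List.lookup codes (index σ∈)))
        ≡⟨ φ-cong F (λ k → trans (cong (λ τ → Vec.lookup τ k) (sym (lookup-index σ∈))) (lookup∘tabulate σ k)) ⟩
      φ F σ                                              ≡⟨ φσ≡x ⟩
      face i≤m x                                         ∎)

  vertices-of-face : ∀ {i} (i≤m : i ≤ m) x → count (λ v → vertex v ⊆? face i≤m x) ≡ 2 ^ i
  vertices-of-face {i} i≤m x = begin
    count (λ v → vertex v ⊆? face i≤m x)  ≡⟨ count-codes z≤n F _ (corners-unique σ)
      (λ τ∈ → proj₁ (corners-sound σ τ∈))
      (λ τ∈ v≡φτ → λ {j} j∈v → subst (j ∈_) φσ≡x
        (φ-mono F (proj₂ (corners-sound σ τ∈)) (subst (j ∈_) v≡φτ j∈v)))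
      (λ v v⊆x → let (τ , φτ≡v , dim≡0) = φ-onto z≤n F v (λ j∈v → x⊆F (v⊆x j∈v)) in
        τ , φτ≡v , corners-complete σ dim≡0
          (φ-reflect F (λ {j} j∈τ → subst (j ∈_) (sym φσ≡x) (v⊆x (subst (j ∈_) φτ≡v j∈τ))))) ⟩
    length (corners σ)                    ≡⟨ length-corners σ ⟩
    2 ^ cubeDim σ                         ≡⟨ cong (2 ^_) dim≡i ⟩
    2 ^ i                                 ∎
    where
    F = proj₁ (cover i≤m x)
    x⊆F : face i≤m x ⊆ facet F
    x⊆F = proj₂ (cover i≤m x)
    σ = proj₁ (φ-onto i≤m F x x⊆F)
    φσ≡x = proj₁ (proj₂ (φ-onto i≤m F x x⊆F))
    dim≡i = proj₂ (proj₂ (φ-onto i≤m F x x⊆F))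

  incidences : ∀ {i} (i≤m : i ≤ m) →
    2 ^ i * f i ≡ sum λ v → count λ x → vertex v ⊆? face i≤m x
  incidences {i} i≤m = begin
    2 ^ i * f i                                         ≡⟨ ℕ.*-comm (2 ^ i) (f i) ⟩
    f i * 2 ^ i                                         ≡⟨ sum-const (f i) (2 ^ i) ⟨
    sum {f i} (const (2 ^ i))                           ≡⟨ sum-cong-≗ (λ x → vertices-of-face i≤m x) ⟨
    sum (λ x → count λ v → vertex v ⊆? face i≤m x)      ≡⟨ ∑-comm (λ x v → ind (vertex v ⊆? face i≤m x)) ⟩
    sum (λ v → count λ x → vertex v ⊆? face i≤m x)      ∎

  cornerOf : ∀ {v F} → vertex v ⊆ facet F → ∃ λ ρ → φ F ρ ≡ vertex v × cubeDim ρ ≡ 0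
  cornerOf {v} {F} = φ-onto z≤n F v

  module Oriented (_⊴_ : Fin (f m) → Fin (f m) → Set) (⊴-order : IsTotalOrder _≡_ _⊴_)
    (_⊴?_ : ∀ F F′ → Dec (F ⊴ F′)) (local : LocalOptimality _⊴_) where

    Improves : Fin (f m) → CubeFace m → Fin m → Set
    Improves F ρ i = ∃ λ F′ → Adjacent F ρ i F′ × F ⊴ F′

    Improves? : ∀ F ρ i → Dec (Improves F ρ i)
    Improves? F ρ i = Fin.any? λ F′ → (¬? (F′ Fin.≟ F) ×-dec (φ F (ridge ρ i) ⊆? facet F′)) ×-dec (F ⊴? F′)

    First : Subset n → Fin (f m) → Set
    First T F = T ⊆ facet F × (∀ F′ → T ⊆ facet F′ → F ⊴ F′)

    First? : ∀ T F → Dec (First T F)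
    First? T F = (T ⊆? facet F) ×-dec Fin.all? λ F′ → (T ⊆? facet F′) →-dec (F ⊴? F′)

    one-first : ∀ {i} (i≤m : i ≤ m) x → count (First? (face i≤m x)) ≡ 1
    one-first i≤m x with minimum ⊴-order (f m) (λ F → face i≤m x ⊆? facet F) id
    ... | inj₂ none = ⊥-elim (none (proj₁ (cover i≤m x)) (proj₂ (cover i≤m x)))
    ... | inj₁ (F , x⊆F , min) = count-unique _ F (x⊆F , min) λ F′ (x⊆F′ , min′) →
      IsTotalOrder.antisym ⊴-order (min′ F x⊆F) (min F′ x⊆F′)

    -- The value 0 for pairs that are not flags is a filler; it only occurs multiplied by an
    -- indicator that vanishes.
    ascents : ∀ v F → Dec (vertex v ⊆ facet F) → ℕ
    ascents v F (yes v⊆F) = count (Improves? F (proj₁ (cornerOf v⊆F)))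
    ascents v F (no _)    = 0

    -- A face of codimension k at v whose first facet is F is fixed in k of the ascending directions.
    faces-with-first : ∀ {i k} (i≤m : i ≤ m) → i + k ≡ m → ∀ v F (v⊆F? : Dec (vertex v ⊆ facet F)) →
      count (λ x → (vertex v ⊆? face i≤m x) ×-dec First? (face i≤m x) F) ≡ ind v⊆F? * (ascents v F v⊆F? C k)
    faces-with-first i≤m i+k≡m v F (no v⊈F) =
      count-none (λ x → (vertex v ⊆? face i≤m x) ×-dec First? (face i≤m x) F) λ x (v⊆x , x⊆F , _) → v⊈F (λ j∈v → x⊆F (v⊆x j∈v))
    faces-with-first {i} {k} i≤m i+k≡m v F (yes v⊆F) = begin
      count (λ x → (vertex v ⊆? face i≤m x) ×-dec First? (face i≤m x) F)
        ≡⟨ count-codes i≤m F _ (stars-unique ρ fixed U? k)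
             (λ τ∈ → ℕ.+-cancelʳ-≡ k _ _ (trans (proj₂ (stars-sound ρ fixed U? k τ∈)) (sym i+k≡m)))
             sound complete ⟩
      length (stars ρ U? k)              ≡⟨ length-stars ρ U? k ⟩
      count U? C k                       ≡⟨ ℕ.*-identityˡ _ ⟨
      1 * (count U? C k)                 ∎
      where
      ρ = proj₁ (cornerOf v⊆F)
      φρ≡v = proj₁ (proj₂ (cornerOf v⊆F))
      dim-ρ = proj₂ (proj₂ (cornerOf v⊆F))
      fixed : ∀ j → ρ j ≢ free
      fixed = corner ρ dim-ρ
      U? = Improves? F ρ
      sound : ∀ {τ x} → τ ∈ₗ stars ρ U? k → face i≤m x ≡ φ F (Vec.lookup τ) →
        vertex v ⊆ face i≤m x × First (face i≤m x) F
      sound {τ} {x} τ∈ x≡φτ =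
        (λ {j} j∈v → subst (j ∈_) (sym x≡φτ) (φ-mono F ρ⊑τ (subst (j ∈_) (sym φρ≡v) j∈v)))
        , (λ {j} j∈x → φ-facet F (Vec.lookup τ) (subst (j ∈_) x≡φτ j∈x))
        , λ F′ x⊆F′ → local F dim-ρ ρ⊑τ
            (λ l τₗ≢free → case within l of λ where
              (inj₁ τₗ≡free) → contradiction τₗ≡free τₗ≢free
              (inj₂ (_ , u)) → u)
            F′ (λ {j} j∈τ → x⊆F′ (subst (j ∈_) (sym x≡φτ) j∈τ))
        where
        within = proj₁ (stars-sound ρ fixed U? k τ∈)
        ρ⊑τ : ρ ⊑c Vec.lookup τ
        ρ⊑τ l = case within l of λ where
          (inj₁ τₗ≡free)     → subst (ρ l ≤c_) (sym τₗ≡free) (≤c-free (ρ l))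
          (inj₂ (τₗ≡ρₗ , _)) → ≤c-reflexive (sym τₗ≡ρₗ)
      complete : ∀ x → vertex v ⊆ face i≤m x × First (face i≤m x) F →
        ∃ λ σ → φ F σ ≡ face i≤m x × Vec.tabulate σ ∈ₗ stars ρ U? k
      complete x (v⊆x , x⊆F , first) with φ-onto i≤m F x x⊆F
      ... | σ , φσ≡x , dim-σ = σ , φσ≡x
        , stars-complete ρ fixed U? k (within , trans (cong (_+ k) dim-σ) i+k≡m)
        where
        ρ⊑σ : ρ ⊑c σ
        ρ⊑σ = φ-reflect F λ {j} j∈ρ → subst (j ∈_) (sym φσ≡x) (v⊆x (subst (j ∈_) φρ≡v j∈ρ))
        within : ∀ l → σ l ≡ free ⊎ (σ l ≡ ρ l × Improves F ρ l)
        within l with free≟ (σ l)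
        ... | yes σₗ≡free = inj₁ σₗ≡free
        -- The ridge in a fixed direction contains the face, hence so does the facet across it,
        -- which cannot precede the first facet `F`.
        ... | no σₗ≢free  = inj₂ (sym ρₗ≡σₗ , F′ , adj , first F′ λ {j} j∈x →
              proj₂ adj (φ-mono F (⊑ridge {ρ = ρ} {σ} l (sym ρₗ≡σₗ)) (subst (j ∈_) (sym φσ≡x) j∈x)))
          where
          ρₗ≡σₗ = ≤c-fixed (ρ⊑σ l) σₗ≢free
          F′ = proj₁ (adjacent F dim-ρ l)
          adj = proj₂ (adjacent F dim-ρ l)

    -- Every incidence of a vertex with a face is charged to the unique first facet of the face.
    flag-count : ∀ {i k} (i≤m : i ≤ m) → i + k ≡ m → 2 ^ i * f i ≡
      sum λ v → sum λ F → ind (vertex v ⊆? facet F) * (ascents v F (vertex v ⊆? facet F) C k)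
    flag-count {i} {k} i≤m i+k≡m = trans (incidences i≤m) (sum-cong-≗ λ v → begin
      count (λ x → vertex v ⊆? face i≤m x)
        ≡⟨ sum-cong-≗ (λ x → trans (sym (ℕ.*-identityʳ _))
             (trans (cong (ind (vertex v ⊆? face i≤m x) *_) (sym (one-first i≤m x)))
               (*-distribˡ-sum (ind (vertex v ⊆? face i≤m x)) (λ F → ind (First? (face i≤m x) F))))) ⟩
      sum (λ x → sum λ F → ind (vertex v ⊆? face i≤m x) * ind (First? (face i≤m x) F))
        ≡⟨ ∑-comm (λ x F → ind (vertex v ⊆? face i≤m x) * ind (First? (face i≤m x) F)) ⟩
      sum (λ F → sum λ x → ind (vertex v ⊆? face i≤m x) * ind (First? (face i≤m x) F))
        ≡⟨ sum-cong-≗ (λ F → trans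
             (sum-cong-≗ λ x → ind-× (vertex v ⊆? face i≤m x) (First? (face i≤m x) F))
             (faces-with-first i≤m i+k≡m v F (vertex v ⊆? facet F))) ⟩
      sum (λ F → ind (vertex v ⊆? facet F) * (ascents v F (vertex v ⊆? facet F) C k)) ∎)

  module Up = Oriented _≼_ isTotalOrder _≼?_ local-min
  module Down = Oriented (flip _≼_) (Flip.isTotalOrder isTotalOrder) (flip _≼?_) local-max

  ascents+descents : ∀ v F (v⊆F? : Dec (vertex v ⊆ facet F)) →
    vertex v ⊆ facet F → Up.ascents v F v⊆F? + Down.ascents v F v⊆F? ≡ m
  ascents+descents v F (no v⊈F) v⊆F = ⊥-elim (v⊈F v⊆F)
  ascents+descents v F (yes v⊆F) _ = begin
    count (Up.Improves? F ρ) + count (Down.Improves? F ρ)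
      ≡⟨ ∑-distrib-+ (λ i → ind (Up.Improves? F ρ i)) (λ i → ind (Down.Improves? F ρ i)) ⟨
    sum (λ i → ind (Up.Improves? F ρ i) + ind (Down.Improves? F ρ i))
      ≡⟨ sum-cong-≗ exactly-one ⟩
    sum {m} (const 1)    ≡⟨ sum-const m 1 ⟩
    m * 1                ≡⟨ ℕ.*-identityʳ m ⟩
    m                    ∎
    where
    ρ = proj₁ (cornerOf v⊆F)
    dim-ρ = proj₂ (proj₂ (cornerOf v⊆F))
    -- The ridge itself has `i` as its only fixed direction, so by local optimality one later
    -- neighbour places every facet through the ridge after `F`. This stands in for uniqueness of
    -- the facet across a ridge.
    not-both : ∀ i → Up.Improves F ρ i → ¬ Down.Improves F ρ i
    not-both i up (F″ , (F″≢F , ridge⊆F″) , F″≼F) = F″≢F (antisym F″≼F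
      (local-min F dim-ρ (⊑ridge {ρ = ρ} {ρ} i refl) only-i F″ ridge⊆F″))
      where
      only-i : ∀ j → ridge ρ i j ≢ free → Up.Improves F ρ j
      only-i j fixed with j Fin.≟ i
      ... | yes refl = up
      ... | no j≢i   = contradiction (ridge-off ρ i j j≢i) fixed
    exactly-one : ∀ i → ind (Up.Improves? F ρ i) + ind (Down.Improves? F ρ i) ≡ 1
    exactly-one i with Up.Improves? F ρ i | Down.Improves? F ρ i
    ... | yes up | yes down = contradiction down (not-both i up)
    ... | yes _  | no _     = refl
    ... | no _   | yes _    = refl
    ... | no ¬up | no ¬down with adjacent F dim-ρ i
    ...   | F′ , adj = ⊥-elim ([ (λ F≼F′ → ¬up (F′ , adj , F≼F′)) , (λ F′≼F → ¬down (F′ , adj , F′≼F)) ]′ (total F F′))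

  -- A facet `F` at `v` contributes the `m` edges of its cube. A facet across one of its ridges at
  -- `v` contributes a further edge, one that leaves `F`.
  degree : (1≤m : 1 ≤ m) → ∀ v → suc m ≤ count λ x → vertex v ⊆? face 1≤m x
  degree 1≤m v = count-≥ _ h h-injective contains
    where
    F = proj₁ (cover z≤n v)
    v⊆F : vertex v ⊆ facet F
    v⊆F = proj₂ (cover z≤n v)
    ρ = proj₁ (cornerOf v⊆F)
    φρ≡v = proj₁ (proj₂ (cornerOf v⊆F))
    dim-ρ = proj₂ (proj₂ (cornerOf v⊆F))
    direction : ∀ {m} → 1 ≤ m → Fin m
    direction (s≤s _) = zero
    i₀ = direction 1≤m
    F′ = proj₁ (adjacent F dim-ρ i₀)
    adj = proj₂ (adjacent F dim-ρ i₀)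
    v⊆F′ : vertex v ⊆ facet F′
    v⊆F′ {j} j∈v = proj₂ adj (φ-mono F (⊑ridge {ρ = ρ} {ρ} i₀ refl) (subst (j ∈_) (sym φρ≡v) j∈v))
    ρ′ = proj₁ (cornerOf v⊆F′)
    φρ′≡v = proj₁ (proj₂ (cornerOf v⊆F′))
    dim-ρ′ = proj₂ (proj₂ (cornerOf v⊆F′))
    out = edge-out F′ F (proj₁ adj) dim-ρ′ (λ {j} j∈ρ′ → v⊆F (subst (j ∈_) φρ′≡v j∈ρ′))
    outer : ∃ λ x → face 1≤m x ≡ φ F′ (edge ρ′ (proj₁ out))
    outer = φ-face 1≤m F′ _ (cubeDim-edge ρ′ (proj₁ out) dim-ρ′)
    inner : ∀ i → ∃ λ x → face 1≤m x ≡ φ F (edge ρ i)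
    inner i = φ-face 1≤m F _ (cubeDim-edge ρ i dim-ρ)
    h : Fin (suc m) → Fin (f 1)
    h zero    = proj₁ outer
    h (suc i) = proj₁ (inner i)
    outer≢inner : ∀ i → proj₁ outer ≢ proj₁ (inner i)
    outer≢inner i e = proj₂ out λ {j} j∈ → φ-facet F (edge ρ i)
      (subst (j ∈_) (trans (sym (proj₂ outer)) (trans (cong (face 1≤m) e) (proj₂ (inner i)))) j∈)
    inner-injective : ∀ {i j} → proj₁ (inner i) ≡ proj₁ (inner j) → i ≡ j
    inner-injective {i} {j} e with i Fin.≟ j
    ... | yes i≡j = i≡j
    ... | no i≢j  = contradiction
      (trans (sym (edge-off ρ j i i≢j)) (trans (sym (φ-injective F edges≡ i)) (edge-at ρ i)))
      (corner ρ dim-ρ i)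
      where
      edges≡ : φ F (edge ρ i) ≡ φ F (edge ρ j)
      edges≡ = trans (sym (proj₂ (inner i))) (trans (cong (face 1≤m) e) (proj₂ (inner j)))
    h-injective : ∀ {x y} → h x ≡ h y → x ≡ y
    h-injective {zero}  {zero}  _ = refl
    h-injective {zero}  {suc j} e = contradiction e (outer≢inner j)
    h-injective {suc i} {zero}  e = contradiction (sym e) (outer≢inner i)
    h-injective {suc i} {suc j} e = cong suc (inner-injective e)
    contains : ∀ y → vertex v ⊆ face 1≤m (h y)
    contains zero {j} j∈v = subst (j ∈_) (sym (proj₂ outer))
      (φ-mono F′ (ρ⊑edge ρ′ (proj₁ out)) (subst (j ∈_) (sym φρ′≡v) j∈v))
    contains (suc i) {j} j∈v = subst (j ∈_) (sym (proj₂ (inner i)))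
      (φ-mono F (ρ⊑edge ρ i) (subst (j ∈_) (sym φρ≡v) j∈v))

  many-edges : 1 ≤ m → suc m * f 0 ≤ 2 * f 1
  many-edges 1≤m = subst₂ _≤_ (trans (sum-const (f 0) (suc m)) (ℕ.*-comm (f 0) (suc m)))
    (sym (incidences 1≤m)) (sum-mono (degree 1≤m))

-- Linear inequalities between face numbers

Descends : ℕ → (ℕ → ℕ) → ℕ → Set
Descends d f j = suc (suc j) < d → f (suc j) ≤ f j → f (suc (suc j)) ≤ f (suc j)

-- From `p` on, one weak descent forces all later ones. The peak is therefore the first index from
-- `p` on at which a descent begins, or else the last index.
unimodal : ∀ {d p f} → p < d → (∀ j → j < p → f j ≤ f (suc j)) → (∀ j → p ≤ j → Descends d f j) → Unimodal d f
unimodal {d} {p} {f} p<d up down = go (d ∸ suc p) p ℕ.≤-refl p<d (ℕ.m∸n+n≡m p<d) up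
  where
  descend : ∀ i → p ≤ i → f (suc i) ≤ f i → ∀ j → i ℕ.≤′ j → suc j < d → f (suc j) ≤ f j
  descend i p≤i fall .i     ℕ.≤′-refl       _ = fall
  descend i p≤i fall (suc j) (ℕ.≤′-step i≤j) 2+j<d =
    down j (ℕ.≤-trans p≤i (ℕ.≤′⇒≤ i≤j)) 2+j<d (descend i p≤i fall j i≤j (ℕ.<⇒≤ 2+j<d))
  go : ∀ fuel i → p ≤ i → i < d → fuel + suc i ≡ d → (∀ j → j < i → f j ≤ f (suc j)) → Unimodal d f
  go zero i p≤i i<d eq rise =
    i , i<d , rise , λ j i≤j 1+j<d → contradiction
      (ℕ.≤-trans 1+j<d (ℕ.≤-trans (ℕ.≤-reflexive (sym eq)) (s≤s i≤j))) (ℕ.<-irrefl refl)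
  go (suc fuel) i p≤i i<d eq rise with f (suc i) ≤? f i
  ... | yes fall = i , i<d , rise , λ j i≤j → descend i p≤i fall j (ℕ.≤⇒≤′ i≤j)
  ... | no ¬fall = go fuel (suc i) (ℕ.m≤n⇒m≤1+n p≤i)
    (ℕ.≤-trans (s≤s (ℕ.m≤n+m (suc i) fuel)) (ℕ.≤-reflexive eq)) (trans (ℕ.+-suc fuel (suc i)) eq) rise′
    where
    rise′ : ∀ j → j < suc i → f j ≤ f (suc j)
    rise′ j (s≤s j≤i) with ℕ.m≤n⇒m<n∨m≡n j≤i
    ... | inj₁ j<i  = rise j j<i
    ... | inj₂ refl = ℕ.<⇒≤ (ℕ.≰⇒> ¬fall)

unimodal? : ∀ d f → Dec (Unimodal d f)
unimodal? d f = Dec.map′ to from (Fin.any? λ (i : Fin d) →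
  (Fin.all? {toℕ i} λ j → f (toℕ j) ≤? f (suc (toℕ j))) ×-dec
  (Fin.all? {d} λ j → (toℕ i ≤? toℕ j) →-dec ((suc (toℕ j) <? d) →-dec (f (suc (toℕ j)) ≤? f (toℕ j)))))
  where
  to : _ → Unimodal d f
  to (i , up , down) = toℕ i , Fin.toℕ<n i
    , (λ j j<i → subst (λ j → f j ≤ f (suc j)) (Fin.toℕ-fromℕ< j<i) (up (fromℕ< j<i)))
    , λ j i≤j 1+j<d → subst (λ j → toℕ i ≤ j → suc j < d → f (suc j) ≤ f j) (Fin.toℕ-fromℕ< (ℕ.<⇒≤ 1+j<d))
        (down (fromℕ< (ℕ.<⇒≤ 1+j<d))) i≤j 1+j<d
  from : Unimodal d f → _
  from (i , i<d , up , down) = fromℕ< i<d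
    , (λ j → up (toℕ j) (subst (toℕ j <_) (Fin.toℕ-fromℕ< i<d) (Fin.toℕ<n j)))
    , λ j i≤j → down (toℕ j) (subst (_≤ toℕ j) (Fin.toℕ-fromℕ< i<d) i≤j)

-- 2 ^ (1 + m) f i is the sum of weight m i x over the flags (vertex, facet), x being the number of
-- ascents of the flag.
weight : ℕ → ℕ → ℕ → ℕ
weight m i x = 2 ^ (m ∸ i) * (x C (m ∸ i) + (m ∸ x) C (m ∸ i))

-- Linear forms as pairs of coefficient and index. Both sides of an inequality carry natural
-- coefficients, so subtraction is avoided.
Form : Set
Form = List (ℕ × ℕ)

eval : (ℕ → ℕ) → Form → ℕ
eval g []            = 0
eval g ((c , i) ∷ L) = c * g i + eval g L

riseˡ riseʳ : ℕ → Form
riseˡ j = (1 , j) ∷ []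
riseʳ j = (1 , suc j) ∷ []

-- The comparison of two consecutive differences, with negative terms moved across. The second entry
-- of the pair is one less than the multiplier, so that the multiplier is positive and can be
-- cancelled.
fallˡ fallʳ : ℕ × ℕ → ℕ → Form
fallˡ (p , q) j = (suc q , suc (suc j)) ∷ (p , j) ∷ []
fallʳ (p , q) j = (p + suc q , suc j) ∷ []

evalᵂ : ℕ → Form → ℕ → ℕ
evalᵂ m L x = eval (λ i → weight m i x) L

slack : ℕ → Form → Form → ℕ
slack m L R = evalᵂ m L 0 ∸ evalᵂ m R 0

-- The termwise comparison may use a multiple of (1 + m) f 0 ≤ 2 f 1, whose left side exceeds the
-- right by 2 ^ m at x = 0 and x = m; this determines the scale and the slack.
Certified : ℕ → Form → Form → Set
Certified m L R = ∀ x → x ≤ m →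
  2 ^ m * evalᵂ m L x + slack m L R * (2 * weight m 1 x) ≤ 2 ^ m * evalᵂ m R x + slack m L R * (suc m * weight m 0 x)

-- From coefficients on flags to inequalities

module Estimates {m n : ℕ} {f : ℕ → ℕ} (S : CubicalSphere m n f) where
  open CubicalSphere S using (facet)
  open Counting S

  private
    ω : Fin (f 0) → Fin (f m) → ℕ
    ω v F = ind (vertex v ⊆? facet F)
    a b : Fin (f 0) → Fin (f m) → ℕ
    a v F = Up.ascents v F (vertex v ⊆? facet F)
    b v F = Down.ascents v F (vertex v ⊆? facet F)

  -- The pairing of `g` with the short cubical h-vector.
  total : (ℕ → ℕ) → ℕ
  total g = sum λ v → sum λ F → ω v F * g (a v F)

  total-+ : ∀ g h → total (λ x → g x + h x) ≡ total g + total h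
  total-+ g h = trans
    (sum-cong-≗ λ v → trans (sum-cong-≗ λ F → ℕ.*-distribˡ-+ (ω v F) (g (a v F)) (h (a v F)))
      (∑-distrib-+ (λ F → ω v F * g (a v F)) (λ F → ω v F * h (a v F))))
    (∑-distrib-+ (λ v → sum λ F → ω v F * g (a v F)) (λ v → sum λ F → ω v F * h (a v F)))

  total-* : ∀ c g → total (λ x → c * g x) ≡ c * total g
  total-* c g = trans
    (sum-cong-≗ λ v → trans (sum-cong-≗ λ F → swap (ω v F) c (g (a v F)))
      (sym (*-distribˡ-sum c (λ F → ω v F * g (a v F)))))
    (sym (*-distribˡ-sum c (λ v → sum λ F → ω v F * g (a v F))))
    where
    swap : ∀ x y z → x * (y * z) ≡ y * (x * z)
    swap = solve-∀

  total-mono : ∀ g h → (∀ x → x ≤ m → g x ≤ h x) → total g ≤ total h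
  total-mono g h g≤h = sum-mono λ v → sum-mono λ F → bound v F (vertex v ⊆? facet F)
    where
    bound : ∀ v F (v⊆F? : Dec (vertex v ⊆ facet F)) →
      ind v⊆F? * g (Up.ascents v F v⊆F?) ≤ ind v⊆F? * h (Up.ascents v F v⊆F?)
    bound v F (no _) = z≤n
    bound v F v⊆F?@(yes v⊆F) = ℕ.*-monoʳ-≤ 1 (g≤h _ (ℕ.m+n≤o⇒m≤o _ (ℕ.≤-reflexive (ascents+descents v F v⊆F? v⊆F))))

  descents : ∀ (g : ℕ → ℕ) → sum (λ v → sum λ F → ω v F * g (b v F)) ≡ total (λ x → g (m ∸ x))
  descents g = sum-cong-≗ λ v → sum-cong-≗ λ F → same v F (vertex v ⊆? facet F)
    where
    same : ∀ v F (v⊆F? : Dec (vertex v ⊆ facet F)) →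
      ind v⊆F? * g (Down.ascents v F v⊆F?) ≡ ind v⊆F? * g (m ∸ Up.ascents v F v⊆F?)
    same v F (no _) = refl
    same v F v⊆F?@(yes v⊆F) = cong (λ x → 1 * g x) (begin
      Down.ascents v F v⊆F?                            ≡⟨ ℕ.m+n∸m≡n (Up.ascents v F v⊆F?) _ ⟨
      Up.ascents v F v⊆F? + Down.ascents v F v⊆F? ∸ Up.ascents v F v⊆F?
        ≡⟨ cong (_∸ Up.ascents v F v⊆F?) (ascents+descents v F v⊆F? v⊆F) ⟩
      m ∸ Up.ascents v F v⊆F?                          ∎)

  -- Adding the equations of both orders symmetrises the coefficients under exchange of `x` and m -
  -- x and doubles the left side. The power of 2 in the weight then gives all face numbers the
  -- common factor 2 ^ (1 + m).
  total-weight : ∀ i → i ≤ m → 2 ^ suc m * f i ≡ total (weight m i)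
  total-weight i i≤m = begin
    2 ^ suc m * f i
      ≡⟨ cong (λ k → 2 * 2 ^ k * f i) (ℕ.m∸n+n≡m i≤m) ⟨
    2 * 2 ^ (m ∸ i + i) * f i
      ≡⟨ cong (λ z → 2 * z * f i) (ℕ.^-distribˡ-+-* 2 (m ∸ i) i) ⟩
    2 * (2 ^ (m ∸ i) * 2 ^ i) * f i
      ≡⟨ double (2 ^ (m ∸ i)) (2 ^ i) (f i) ⟩
    2 ^ (m ∸ i) * (2 ^ i * f i + 2 ^ i * f i)
      ≡⟨ cong₂ (λ y z → 2 ^ (m ∸ i) * (y + z)) (Up.flag-count i≤m codim)
           (trans (Down.flag-count i≤m codim) (descents (_C (m ∸ i)))) ⟩
    2 ^ (m ∸ i) * (total (_C (m ∸ i)) + total (λ x → (m ∸ x) C (m ∸ i)))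
      ≡⟨ cong (2 ^ (m ∸ i) *_) (total-+ (_C (m ∸ i)) (λ x → (m ∸ x) C (m ∸ i))) ⟨
    2 ^ (m ∸ i) * total (λ x → x C (m ∸ i) + (m ∸ x) C (m ∸ i))
      ≡⟨ total-* (2 ^ (m ∸ i)) (λ x → x C (m ∸ i) + (m ∸ x) C (m ∸ i)) ⟨
    total (weight m i) ∎
    where
    codim : i + (m ∸ i) ≡ m
    codim = ℕ.m+[n∸m]≡n i≤m
    double : ∀ x y z → 2 * (x * y) * z ≡ x * (y * z + y * z)
    double = solve-∀

  total-zero : total (const 0) ≡ 0
  total-zero = total-* 0 (const 0)

  eval-total : ∀ L → All (λ (_ , i) → i ≤ m) L → 2 ^ suc m * eval f L ≡ total (evalᵂ m L)
  eval-total []            []            = trans (ℕ.*-zeroʳ (2 ^ suc m)) (sym total-zero)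
  eval-total ((c , i) ∷ L) (i≤m ∷ L≤m) = begin
    2 ^ suc m * (c * f i + eval f L)               ≡⟨ distrib (2 ^ suc m) c (f i) (eval f L) ⟩
    c * (2 ^ suc m * f i) + 2 ^ suc m * eval f L   ≡⟨ cong₂ (λ y z → c * y + z) (total-weight i i≤m) (eval-total L L≤m) ⟩
    c * total (weight m i) + total (evalᵂ m L)
      ≡⟨ cong (_+ total (evalᵂ m L)) (total-* c (weight m i)) ⟨
    total (λ x → c * weight m i x) + total (evalᵂ m L)
      ≡⟨ total-+ (λ x → c * weight m i x) (evalᵂ m L) ⟨
    total (evalᵂ m ((c , i) ∷ L)) ∎
    where
    distrib : ∀ p c y z → p * (c * y + z) ≡ c * (p * y) + p * z
    distrib = solve-∀

  -- The certificate is summed over all flags. The correction terms then cancel against `s` copies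
  -- of (1 + m) f_0 ≤ 2 f_1, and the positive powers of 2 are divided out.
  eval-≤ : 1 ≤ m → ∀ L R → All (λ (_ , i) → i ≤ m) L → All (λ (_ , i) → i ≤ m) R → Certified m L R → eval f L ≤ eval f R
  eval-≤ 1≤m L R L≤m R≤m cert = ℕ.*-cancelˡ-≤ P {{ℕ.m^n≢0 2 (suc m)}} (ℕ.*-cancelˡ-≤ N {{ℕ.m^n≢0 2 m}}
    (ℕ.+-cancelʳ-≤ (s * (2 * (P * f 1))) _ _ (ℕ.≤-trans
      (subst₂ _≤_ (sides L L≤m 2 1 1≤m) (sides R R≤m (suc m) 0 z≤n) (total-mono
        (λ x → N * evalᵂ m L x + s * (2 * weight m 1 x))
        (λ x → N * evalᵂ m R x + s * (suc m * weight m 0 x)) cert))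
      (ℕ.+-monoʳ-≤ (N * (P * eval f R)) (ℕ.*-monoʳ-≤ s
        (subst₂ _≤_ (swap P (suc m) (f 0)) (swap P 2 (f 1)) (ℕ.*-monoʳ-≤ P (many-edges 1≤m))))))))
    where
    N P s : ℕ
    N = 2 ^ m
    P = 2 ^ suc m
    s = slack m L R
    swap : ∀ x y z → x * (y * z) ≡ y * (x * z)
    swap = solve-∀
    sides : ∀ L → All (λ (_ , i) → i ≤ m) L → ∀ c i → i ≤ m →
      total (λ x → N * evalᵂ m L x + s * (c * weight m i x)) ≡ N * (P * eval f L) + s * (c * (P * f i))
    sides L L≤m c i i≤m = begin
      total (λ x → N * evalᵂ m L x + s * (c * weight m i x))
        ≡⟨ total-+ (λ x → N * evalᵂ m L x) (λ x → s * (c * weight m i x)) ⟩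
      total (λ x → N * evalᵂ m L x) + total (λ x → s * (c * weight m i x))
        ≡⟨ cong₂ _+_ (total-* N (evalᵂ m L))
             (trans (total-* s (λ x → c * weight m i x)) (cong (s *_) (total-* c (weight m i)))) ⟩
      N * total (evalᵂ m L) + s * (c * total (weight m i))
        ≡⟨ cong₂ (λ y z → N * y + s * (c * z)) (eval-total L L≤m) (total-weight i i≤m) ⟨
      N * (P * eval f L) + s * (c * (P * f i)) ∎

  rise : 1 ≤ m → ∀ j → j < m → Certified m (riseˡ j) (riseʳ j) → f j ≤ f (suc j)
  rise 1≤m j j<m cert = subst₂ _≤_ (unit (f j)) (unit (f (suc j)))
    (eval-≤ 1≤m (riseˡ j) (riseʳ j) (ℕ.<⇒≤ j<m ∷ []) (j<m ∷ []) cert)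
    where
    unit : ∀ x → 1 * x + 0 ≡ x
    unit = solve-∀

  -- A positive multiple of the next difference is at most `p` times the current one, which is
  -- nonpositive by assumption.
  fall : ∀ j (r : ℕ × ℕ) → suc (suc j) ≤ m → Certified m (fallˡ r j) (fallʳ r j) →
    f (suc j) ≤ f j → f (suc (suc j)) ≤ f (suc j)
  fall j r@(p , q) j+2≤m cert fⱼ₊₁≤fⱼ = ℕ.*-cancelˡ-≤ (suc q) (ℕ.+-cancelʳ-≤ (p * f j) _ _ (ℕ.≤-trans
    (subst₂ _≤_ (left (suc q * f (suc (suc j))) (p * f j)) (right p (suc q) (f (suc j)))
      (eval-≤ (ℕ.≤-trans (s≤s z≤n) j+2≤m) (fallˡ r j) (fallʳ r j) (j+2≤m ∷ ℕ.<⇒≤ (ℕ.<⇒≤ j+2≤m) ∷ []) (ℕ.<⇒≤ j+2≤m ∷ []) cert))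
    (ℕ.+-monoʳ-≤ (suc q * f (suc j)) (ℕ.*-monoʳ-≤ p fⱼ₊₁≤fⱼ))))
    where
    left : ∀ x y → x + (y + 0) ≡ x + y
    left = solve-∀
    right : ∀ p q x → (p + q) * x + 0 ≡ q * x + p * x
    right = solve-∀

-- Numerical certificates

-- Below the index peakStart m the face numbers increase; from there on the differences
-- D j = f (1 + j) - f j satisfy q D (1 + j) ≤ p D j, where ratio m j = (p , q - 1).
peakStart : ℕ → ℕ
peakStart 4 = 1
peakStart 5 = 1
peakStart 6 = 2
peakStart 7 = 2
peakStart 8 = 3
peakStart 9 = 3
peakStart _ = 0

ratio : ℕ → ℕ → ℕ × ℕ
ratio 3 0 = 1 , 0
ratio 5 1 = 1 , 0
ratio 6 2 = 1 , 0
ratio 7 2 = 2 , 0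
ratio 8 3 = 1 , 0
ratio 9 3 = 2 , 0
ratio 9 4 = 1 , 1
-- The default asks for 8 D (1 + j) ≤ D j, which the certificates confirm at all remaining pairs in
-- use.
ratio _ _ = 1 , 7

Certificate : ℕ → Set
Certificate m =
  peakStart m ≤ m ×
  (∀ (j : Fin (peakStart m)) → toℕ j < m × Certified m (riseˡ (toℕ j)) (riseʳ (toℕ j))) ×
  (∀ (j : Fin m) → peakStart m ≤ toℕ j → suc (suc (toℕ j)) ≤ m →
    Certified m (fallˡ (ratio m (toℕ j)) (toℕ j)) (fallʳ (ratio m (toℕ j)) (toℕ j)))

certified? : ∀ m L R → Dec (Certified m L R)
certified? m L R = Dec.map′
  (λ all x x≤m → subst (λ x → 2 ^ m * evalᵂ m L x + slack m L R * (2 * weight m 1 x)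
      ≤ 2 ^ m * evalᵂ m R x + slack m L R * (suc m * weight m 0 x)) (Fin.toℕ-fromℕ< (s≤s x≤m)) (all (fromℕ< (s≤s x≤m))))
  (λ cert x → cert (toℕ x) (ℕ.≤-pred (Fin.toℕ<n x)))
  (Fin.all? {suc m} λ x → (2 ^ m * evalᵂ m L (toℕ x) + slack m L R * (2 * weight m 1 (toℕ x)))
    ≤? (2 ^ m * evalᵂ m R (toℕ x) + slack m L R * (suc m * weight m 0 (toℕ x))))

certificate? : ∀ m → Dec (Certificate m)
certificate? m =
  (peakStart m ≤? m) ×-dec
  (Fin.all? λ j → (toℕ j <? m) ×-dec certified? m (riseˡ (toℕ j)) (riseʳ (toℕ j))) ×-dec
  (Fin.all? λ j → (peakStart m ≤? toℕ j) →-dec ((suc (suc (toℕ j)) ≤? m) →-dec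
    certified? m (fallˡ (ratio m (toℕ j)) (toℕ j)) (fallʳ (ratio m (toℕ j)) (toℕ j))))

-- The bound d ≤ 10 enters through this finite check. For each `m` up to 9 it compares natural
-- numbers at x = 0, ..., m, and is settled by evaluating the decision procedure.
certificates : ∀ (m : Fin 10) → Certificate (toℕ m)
certificates = toWitness {a? = Fin.all? {10} λ m → certificate? (toℕ m)} _

cubicalSphere-unimodal : ∀ {m n f} → m ≤ 9 → CubicalSphere m n f → Unimodal (suc m) f
cubicalSphere-unimodal {m} {f = f} m≤9 S = unimodal (s≤s start≤m)
  (λ j j<p → let (j<m , cert) = rises′ j j<p in rise (ℕ.≤-trans (s≤s z≤n) j<m) j j<m cert)
  (λ { j p≤j (s≤s 2+j≤m) → fall j (ratio m j) 2+j≤m (falls′ j (ℕ.<⇒≤ 2+j≤m) p≤j 2+j≤m) })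
  where
  open Estimates S
  certificate : Certificate m
  certificate = subst Certificate (Fin.toℕ-fromℕ< (s≤s m≤9)) (certificates (fromℕ< (s≤s m≤9)))
  start≤m = proj₁ certificate
  rises = proj₁ (proj₂ certificate)
  falls = proj₂ (proj₂ certificate)
  rises′ : ∀ j → j < peakStart m → j < m × Certified m (riseˡ j) (riseʳ j)
  rises′ j j<p = subst (λ j → j < m × Certified m (riseˡ j) (riseʳ j)) (Fin.toℕ-fromℕ< j<p) (rises (fromℕ< j<p))
  falls′ : ∀ j → j < m → peakStart m ≤ j → suc (suc j) ≤ m → Certified m (fallˡ (ratio m j) j) (fallʳ (ratio m j) j)
  falls′ j j<m = subst (λ j → peakStart m ≤ j → suc (suc j) ≤ m → Certified m (fallˡ (ratio m j) j) (fallʳ (ratio m j) j))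
    (Fin.toℕ-fromℕ< j<m) (falls (fromℕ< j<m))

theorem3 : (K : OrderedField) (d : ℕ) → 1 ≤ d → d ≤ 10 →
    (n : ℕ) (V : Fin n → Point K d) →
    IsPolytope K V → IsCubical K V →
    (f : ℕ → ℕ) → (∀ i → i < d → FaceCount K V i (f i)) →
    Unimodal d f
theorem3 K (suc m) _ (s≤s m≤9) n V polytope cubical f counts = decidable-stable (unimodal? (suc m) f) (do
  S ← Build.sphere K V polytope cubical f counts
  return (cubicalSphere-unimodal m≤9 S))
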